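{- Fix an integer $d\ge0$, let $f_d(r)$ be the number of $d$-dimensional faces of the Kostka polytope $P_r$ ($r\ge1$), and set $d_{\min}=\left\lfloor\frac{d+3}{2}\right\rfloor$. Then for all $r\ge1$, $$f_d(r)=\sum_{k=d_{\min}}^{3d+3}\alpha_k\binom{r}{k},$$ where $\alpha_k=f_d(k)-\sum_{j=d_{\min}}^{k-1}\binom{k}{j}\alpha_j$ for $k>d_{\min}$, and $$\alpha_{d_{\min}}=f_d(d_{\min})=\begin{cases}\frac{3d+5}{2}&\text{if } d \text{ is odd and } d>1,\\ 1&\text{if } d \text{ is even},\\ 3&\text{if } d=1.\end{cases}$$
   Context: For a positive integer $r$, a partition with at most $r$ parts is written as a non-increasing $r$-tuple of nonnegative integers; $\mathrm{Par}_r(n)$ is the set of such tuples with entries summing to $n$. For $\lambda,\mu\in\mathrm{Par}_r(n)$, $\lambda$ dominates $\mu$ if $\sum_{i=1}^k\lambda_i\ge\sum_{i=1}^k\mu_i$ for all $k\le r$. The $r$-Kostka cone $\mathcal{K}_r\subseteq\mathbb{R}^{2r}$ is the convex hull of all points $(\lambda_1,\dots,\lambda_r,\mu_1,\dots,\mu_r)$ with $\lambda,\mu\in\mathrm{Par}_r(n)$ for some $n$ and $\lambda$ dominating $\mu$. The Kostka polytope $P_r$ is the $(2r-2)$-dimensional polytope $\mathcal{K}_r\cap\{x:\sum_{i=1}^r(\lambda_i+\mu_i)=1\}$.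
   Formalization: The Kostka cone and polytope are represented by their rational points, with rational convex combinations, and faces are cut out by rational inequalities; since P_r is a rational polytope, its faces and their dimensions agree with those over the reals. -}

module Defs where

open import Data.Nat as ℕ using (ℕ; zero; suc; _<ᵇ_; _≡ᵇ_; ⌊_/2⌋)
open import Data.Nat.Combinatorics using (_C_)
open import Data.Integer as ℤ using (ℤ; +_)
open import Data.Rational as ℚ using (ℚ; 0ℚ; 1ℚ)
open import Data.Fin using (Fin; zero; suc; toℕ)
import Data.Fin as Fin
open import Data.Bool using (if_then_else_)
open import Data.List using (List; applyUpTo; foldr; map)
open import Data.Product using (Σ; ∃; _×_; _,_)
open import Relation.Nullary using (¬_)
open import Relation.Binary.PropositionalEquality using (_≡_; _≢_)

sumℕ : (n : ℕ) → (Fin n → ℕ) → ℕ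
sumℕ zero    f = 0
sumℕ (suc n) f = f zero ℕ.+ sumℕ n (λ i → f (suc i))

sumℚ : (n : ℕ) → (Fin n → ℚ) → ℚ
sumℚ zero    f = 0ℚ
sumℚ (suc n) f = f zero ℚ.+ sumℚ n (λ i → f (suc i))

-- Σ_{k=a}^{b} g k  (empty if b < a)
sumRangeℤ : ℕ → ℕ → (ℕ → ℤ) → ℤ
sumRangeℤ a b g = foldr ℤ._+_ (+ 0) (applyUpTo (λ i → g (a ℕ.+ i)) (suc b ℕ.∸ a))

-- Partitions and dominance (partitions with at most r parts as
-- non-increasing r-tuples of naturals)

IsPartition : (r : ℕ) → (Fin r → ℕ) → Set
IsPartition r l = ∀ (i j : Fin r) → i Fin.≤ j → l j ℕ.≤ l i

partialSum : (r : ℕ) → ℕ → (Fin r → ℕ) → ℕ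
partialSum r k l = sumℕ r (λ i → if toℕ i <ᵇ k then l i else 0)

Dominates : (r : ℕ) → (Fin r → ℕ) → (Fin r → ℕ) → Set
Dominates r l m = ∀ k → k ℕ.≤ r → partialSum r k m ℕ.≤ partialSum r k l

-- Points of ℚ^{2r} = (λ-coordinates , μ-coordinates)

Point : ℕ → Set
Point r = (Fin r → ℚ) × (Fin r → ℚ)

_≈P_ : {r : ℕ} → Point r → Point r → Set
_≈P_ {r} (x , y) (x' , y') = (∀ i → x i ≡ x' i) × (∀ i → y i ≡ y' i)

zeroP : (r : ℕ) → Point r
zeroP r = (λ _ → 0ℚ) , (λ _ → 0ℚ)

dot : (r : ℕ) → Point r → Point r → ℚ
dot r (c , e) (x , y) = sumℚ r (λ i → c i ℚ.* x i) ℚ.+ sumℚ r (λ i → e i ℚ.* y i)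

lincomb : (r k : ℕ) → (Fin k → ℚ) → (Fin k → Point r) → Point r
lincomb r k t p =
  (λ j → sumℚ k (λ i → t i ℚ.* Data.Product.proj₁ (p i) j)) ,
  (λ j → sumℚ k (λ i → t i ℚ.* Data.Product.proj₂ (p i) j))

toℚ : ℕ → ℚ
toℚ n = + n ℚ./ 1

KostkaGenerator : (r : ℕ) → Point r → Set
KostkaGenerator r p =
  Σ (Fin r → ℕ) λ l → Σ (Fin r → ℕ) λ m →
    IsPartition r l × IsPartition r m × sumℕ r l ≡ sumℕ r m ×
    Dominates r l m × (p ≈P ((λ i → toℚ (l i)) , (λ i → toℚ (m i))))

ConvexHull : (r : ℕ) → (Point r → Set) → Point r → Set
ConvexHull r S x =
  Σ ℕ λ k → Σ (Fin k → ℚ) λ t → Σ (Fin k → Point r) λ p →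
    (∀ i → 0ℚ ℚ.≤ t i) × sumℚ k t ≡ 1ℚ × (∀ i → S (p i)) ×
    (x ≈P lincomb r k t p)

-- the r-Kostka cone 𝒦_r (its rational points)
KostkaCone : (r : ℕ) → Point r → Set
KostkaCone r = ConvexHull r (KostkaGenerator r)

KostkaPolytope : (r : ℕ) → Point r → Set
KostkaPolytope r x = KostkaCone r x × dot r ((λ _ → 1ℚ) , (λ _ → 1ℚ)) x ≡ 1ℚ

ValidIneq : (r : ℕ) → (Point r → Set) → Point r → ℚ → Set
ValidIneq r P c b = ∀ x → P x → dot r c x ℚ.≤ b

FaceOf : (r : ℕ) → (Point r → Set) → Point r → ℚ → Point r → Set
FaceOf r P c b x = P x × dot r c x ≡ b

SameSet : (r : ℕ) → (Point r → Set) → (Point r → Set) → Set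
SameSet r F G = ∀ x → (F x → G x) × (G x → F x)

AffinelyIndependent : (r n : ℕ) → (Fin (suc n) → Point r) → Set
AffinelyIndependent r n v =
  ∀ (t : Fin (suc n) → ℚ) → sumℚ (suc n) t ≡ 0ℚ →
    lincomb r (suc n) t v ≈P zeroP r → ∀ i → t i ≡ 0ℚ

HasDim : (r : ℕ) → (Point r → Set) → ℕ → Set
HasDim r S d =
  (Σ (Fin (suc d) → Point r) λ v → (∀ i → S (v i)) × AffinelyIndependent r d v) ×
  (∀ (v : Fin (suc (suc d)) → Point r) → (∀ i → S (v i)) →
     ¬ AffinelyIndependent r (suc d) v)

IsFaceOfDim : (r : ℕ) → (Point r → Set) → ℕ → Point r → ℚ → Set
IsFaceOfDim r P d c b = ValidIneq r P c b × HasDim r (FaceOf r P c b) d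

HasFaceCount : (r : ℕ) → (Point r → Set) → ℕ → ℕ → Set
HasFaceCount r P d N =
  Σ (Fin N → Point r × ℚ) λ F →
    (∀ i → IsFaceOfDim r P d (Data.Product.proj₁ (F i)) (Data.Product.proj₂ (F i))) ×
    (∀ i j → i ≢ j →
       ¬ SameSet r (FaceOf r P (Data.Product.proj₁ (F i)) (Data.Product.proj₂ (F i)))
                   (FaceOf r P (Data.Product.proj₁ (F j)) (Data.Product.proj₂ (F j)))) ×
    (∀ c b → IsFaceOfDim r P d c b →
       Σ (Fin N) λ i → SameSet r (FaceOf r P c b)
                         (FaceOf r P (Data.Product.proj₁ (F i)) (Data.Product.proj₂ (F i))))

dmin : ℕ → ℕ
dmin d = ⌊ (d ℕ.+ 3) /2⌋

dminValue : ℕ → ℕ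
dminValue d =
  if ℕ._%_ d 2 ≡ᵇ 0 then 1
  else if d ≡ᵇ 1 then 3
  else ⌊ (3 ℕ.* d ℕ.+ 5) /2⌋

{-# OPTIONS --safe #-}
module Submission where

-- For (λ , μ) in the cone put a_k = λ_k - λ_{k+1}, b_k = μ_k - μ_{k+1} (with λ_{r+1} = μ_{r+1} = 0) and
-- D_k = (λ_1 + ... + λ_k) - (μ_1 + ... + μ_k).  The cone is cut out by a, b, D ≥ 0 and D_r = 0, so a face is given by
-- the set of those a_k, b_k, D_k that do not vanish on it, i.e. by a word of length r whose k-th letter is the
-- triple of truth values of D_k ≠ 0, a_k ≠ 0, b_k ≠ 0.  As a_k - b_k is minus the second difference of D at k, the words
-- that occur are the language of a four-state automaton, and the dimension of the face is one less than the
-- additive weight in which a position counts [a] + [b] when D_k ≠ 0 and [a and b] when D_k = 0.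
-- It is at most that because the D_k (at the breaks) and a_k counted by the weight determine the point, and at least
-- that because a word of positive weight can be lowered to one whose weight is smaller by exactly one.
-- Positions with a_k = b_k = 0 can be inserted into a word in exactly one way, so f_d is the binomial transform of the
-- number of words without such positions; those of weight d + 1 have length between d_min and 3d + 3.

open import Defs
open import Data.Bool using (Bool; true; false; T; _∧_)
open import Data.Empty using (⊥; ⊥-elim)
import Data.Integer as ℤ
import Data.Integer.Properties as ℤP
import Data.Integer.Tactic.RingSolver as ℤSolver
open import Data.List as List using (List; []; _∷_; length; lookup; concatMap; applyUpTo; foldr)
open import Data.List.Membership.Propositional using (_∈_)
open import Data.List.Membership.Propositional.Properties using (∈-map⁺; ∈-map⁻; ∈-++⁺ˡ; ∈-++⁺ʳ; ∈-++⁻; ∈-lookup)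
open import Data.List.Properties using (length-map; length-++)
open import Data.List.Relation.Unary.All as All using ([]; _∷_)
open import Data.List.Relation.Unary.AllPairs using ([]; _∷_)
open import Data.List.Relation.Unary.Any using (here; there; index)
open import Data.List.Relation.Unary.Any.Properties using (lookup-index)
open import Data.List.Relation.Unary.Unique.Propositional using (Unique)
import Data.List.Relation.Unary.Unique.Propositional.Properties as UniqueP
open import Data.Maybe using (Maybe; just; nothing)
open import Data.Nat as ℕ using (ℕ; zero; suc; z≤n; s≤s; ⌊_/2⌋)
open import Data.Nat.Combinatorics using (_C_; nCn≡1; k>n⇒nCk≡0; nCk+nC[k+1]≡[n+1]C[k+1])
import Data.Nat.DivMod as DivMod
open import Data.Nat.Induction using (<-rec)
open import Data.Nat.ListAction using (sum)
import Data.Nat.Properties as ℕP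
open import Data.Nat.Tactic.RingSolver using (solve-∀)
open import Data.Product using (Σ; _×_; _,_; proj₁; proj₂)
open import Data.Sum using (_⊎_; inj₁; inj₂)
open import Data.Unit using (⊤; tt)
open import Data.Vec using (Vec; []; _∷_)
open import Data.Vec.Properties using (∷-injectiveʳ)
open import Relation.Binary.PropositionalEquality using (_≡_; _≢_; refl; sym; trans; cong; cong₂; subst; subst₂)
open import Relation.Nullary using (¬_; Dec; yes; no; ¬?)

-- A face is given by an arbitrary valid inequality c · x ≤ b. It is homogenised to the functional b
-- · total - c, which is nonnegative on the cone. Adding one zero of this functional for each of the
-- finitely many words that have one produces a point of maximal support; the support of that point
-- is the word of the face.
--
-- The shape of the automaton comes from the constraints on D: it is 0 at both ends, never negative,
-- bends down only where a is nonzero and up only where b is. An excursion of D above 0 therefore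
-- needs a downward bend inside it, and this bend has positive weight.
--
-- Both ends of the summation range follow, for words without positions a = b = 0. A letter weighs
-- at most 2, and the last one at most 1 because D_r = 0, so weight d + 1 needs length at least
-- d_min. The only weightless letters left have b alone nonzero at D = 0 and start or end an
-- excursion. There are at most two of them per excursion, hence at most three letters per unit of
-- weight, which gives 3 (d + 1).

-- The flags say whether D_k, a_k, b_k may be nonzero.
record Letter : Set where
  constructor ⟨_,_,_⟩
  field
    off lam mu : Bool

-- Support words and the automaton that accepts them

Word : ℕ → Set
Word = Vec Letter

-- What is known about D_k and σ = D_{k+1} - D_k after reading k letters:
-- free: D_k = 0; flat: D_k = σ = 0; rising: D_k ≥ 0 < σ; raised: D_k > 0.
data State : Set where
  free flat rising raised : State

-- From D = 0 with slope 0 the next slope is b - a, and it cannot be negative because D cannot: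
-- `lam` alone is impossible, `mu` alone makes D rise, and both together leave the slope
-- undetermined.
flatStep : Bool → Bool → Maybe State
flatStep false false = just flat
flatStep true  true  = just free
flatStep false true  = just rising
flatStep true  false = nothing

risingStep : Bool → Maybe State
risingStep true  = just raised
risingStep false = just rising

-- In `rising` the slope stays positive until `lam` is set. In `raised`, D can reach 0 only with
-- negative slope and must not pass below, so an upward bend is due there and `mu` has to be set.
step : State → Letter → Maybe State
step flat   ⟨ false , a , b     ⟩ = flatStep a b
step flat   ⟨ true  , a , b     ⟩ = nothing
step rising ⟨ false , a , b     ⟩ = nothing
step rising ⟨ true  , a , b     ⟩ = risingStep a
step raised ⟨ true  , a , b     ⟩ = just raised
step raised ⟨ false , a , true  ⟩ = just free
step raised ⟨ false , a , false ⟩ = nothing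
step free   ⟨ false , a , b     ⟩ = flatStep a b
step free   ⟨ true  , a , b     ⟩ = risingStep a

Accept : State → Set
Accept free   = ⊤
Accept flat   = ⊤
Accept rising = ⊥
Accept raised = ⊥

mutual
  Valid : ∀ {n} → State → Word n → Set
  Valid s []      = Accept s
  Valid s (ℓ ∷ w) = ValidFrom (step s ℓ) w

  ValidFrom : ∀ {n} → Maybe State → Word n → Set
  ValidFrom (just s) w = Valid s w
  ValidFrom nothing  w = ⊥

module Words where

  open import Data.Nat using (_+_; _*_; _≤_; _<_)
  open import Data.Nat.Properties

  -- Weight and order of words

  bit : Bool → ℕ
  bit true  = 1
  bit false = 0

  letterWeight : Letter → ℕ
  letterWeight ⟨ false , a , b ⟩ = bit (a ∧ b)
  letterWeight ⟨ true  , a , b ⟩ = bit a + bit b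

  weight : ∀ {n} → Word n → ℕ
  weight []      = 0
  weight (ℓ ∷ w) = letterWeight ℓ + weight w

  Implies : Bool → Bool → Set
  Implies false b = ⊤
  Implies true  b = T b

  infix 4 _⊑_

  _⊑_ : ∀ {n} → Word n → Word n → Set
  []                  ⊑ []                     = ⊤
  (⟨ d , a , b ⟩ ∷ w) ⊑ (⟨ d' , a' , b' ⟩ ∷ v) = Implies d d' × Implies a a' × Implies b b' × w ⊑ v

  Implies-refl : ∀ b → Implies b b
  Implies-refl true  = tt
  Implies-refl false = tt

  Implies-trans : ∀ a b c → Implies a b → Implies b c → Implies a c
  Implies-trans false b    c _ _ = tt
  Implies-trans true  true c _ h = h

  Implies-antisym : ∀ a b → Implies a b → Implies b a → a ≡ b
  Implies-antisym true  true  _ _ = refl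
  Implies-antisym false false _ _ = refl

  ⊑-refl : ∀ {n} (w : Word n) → w ⊑ w
  ⊑-refl []                  = tt
  ⊑-refl (⟨ d , a , b ⟩ ∷ w) = Implies-refl d , Implies-refl a , Implies-refl b , ⊑-refl w

  ⊑-trans : ∀ {n} (u v w : Word n) → u ⊑ v → v ⊑ w → u ⊑ w
  ⊑-trans [] [] [] _ _ = tt
  ⊑-trans (⟨ d , a , b ⟩ ∷ u) (⟨ d' , a' , b' ⟩ ∷ v) (⟨ d'' , a'' , b'' ⟩ ∷ w) (p , q , r , s) (p' , q' , r' , s') =
    Implies-trans d d' d'' p p' , Implies-trans a a' a'' q q' , Implies-trans b b' b'' r r' , ⊑-trans u v w s s'

  ⊑-antisym : ∀ {n} (u v : Word n) → u ⊑ v → v ⊑ u → u ≡ v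
  ⊑-antisym [] [] _ _ = refl
  ⊑-antisym (⟨ d , a , b ⟩ ∷ u) (⟨ d' , a' , b' ⟩ ∷ v) (p , q , r , s) (p' , q' , r' , s')
    rewrite Implies-antisym d d' p p' | Implies-antisym a a' q q' | Implies-antisym b b' r r' | ⊑-antisym u v s s' = refl

  -- Lowering the weight by exactly one

  Lower Same : ∀ {n} → State → Word n → Set
  Lower {n} s w = Σ (Word n) λ w' → w' ⊑ w × Valid s w' × suc (weight w') ≡ weight w
  Same  {n} s w = Σ (Word n) λ w' → w' ⊑ w × Valid s w' × weight w' ≡ weight w

  free-split : ∀ {n} (w : Word n) → Valid free w → Valid flat w ⊎ Valid rising w
  free-split []                      v = inj₁ v
  free-split (⟨ false , a , b ⟩ ∷ w) v = inj₁ v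
  free-split (⟨ true  , a , b ⟩ ∷ w) v = inj₂ v

  flat⇒free-valid : ∀ {n} (w : Word n) → Valid flat w → Valid free w
  flat⇒free-valid []                      v = v
  flat⇒free-valid (⟨ false , a , b ⟩ ∷ w) v = v

  rising⇒free-valid : ∀ {n} (w : Word n) → Valid rising w → Valid free w
  rising⇒free-valid (⟨ true , a , b ⟩ ∷ w) v = v

  lower-raised : ∀ {n} (w : Word n) → Valid raised w → Valid rising w ⊎ Same flat w ⊎ Lower raised w
  lower-raised (⟨ true , false , false ⟩ ∷ w) v with lower-raised w v
  ... | inj₁ r                            = inj₁ r
  ... | inj₂ (inj₁ (w' , le , v' , e))    = inj₂ (inj₁ (⟨ false , false , false ⟩ ∷ w' , (tt , tt , tt , le) , v' , e))
  ... | inj₂ (inj₂ (w' , le , v' , e))    = inj₂ (inj₂ (⟨ true , false , false ⟩ ∷ w' , (tt , tt , tt , le) , v' , e))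
  lower-raised (⟨ true , false , true ⟩ ∷ w) v = inj₂ (inj₂ (⟨ true , false , false ⟩ ∷ w , (tt , tt , tt , ⊑-refl w) , v , refl))
  lower-raised (⟨ true , true , b ⟩ ∷ w) v = inj₁ v
  lower-raised (⟨ false , true , true ⟩ ∷ w) v = inj₂ (inj₁ (⟨ false , true , true ⟩ ∷ w , (tt , tt , tt , ⊑-refl w) , v , refl))
  lower-raised (⟨ false , false , true ⟩ ∷ w) v with free-split w v
  ... | inj₁ f = inj₂ (inj₁ (⟨ false , false , false ⟩ ∷ w , (tt , tt , tt , ⊑-refl w) , f , refl))
  ... | inj₂ r = inj₂ (inj₁ (⟨ false , false , true ⟩ ∷ w , (tt , tt , tt , ⊑-refl w) , r , refl))

  -- The weight is positive because D has to come down again, and only a letter with `off` and `lam`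
  -- set bends it down. In the case `Lower flat` the current excursion disappears, so a caller that
  -- started it with `mu` drops that flag too.
  lower-rising : ∀ {n} (w : Word n) → Valid rising w → Lower rising w ⊎ Lower flat w
  lower-rising (⟨ true , false , true ⟩ ∷ w) v = inj₁ (⟨ true , false , false ⟩ ∷ w , (tt , tt , tt , ⊑-refl w) , v , refl)
  lower-rising (⟨ true , false , false ⟩ ∷ w) v with lower-rising w v
  ... | inj₁ (w' , le , v' , e) = inj₁ (⟨ true , false , false ⟩ ∷ w' , (tt , tt , tt , le) , v' , e)
  ... | inj₂ (w' , le , v' , e) = inj₂ (⟨ false , false , false ⟩ ∷ w' , (tt , tt , tt , le) , v' , e)
  lower-rising (⟨ true , true , true ⟩ ∷ w) v = inj₁ (⟨ true , true , false ⟩ ∷ w , (tt , tt , tt , ⊑-refl w) , v , refl)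
  lower-rising (⟨ true , true , false ⟩ ∷ w) v with lower-raised w v
  ... | inj₁ r                         = inj₁ (⟨ true , false , false ⟩ ∷ w , (tt , tt , tt , ⊑-refl w) , r , refl)
  ... | inj₂ (inj₁ (w' , le , v' , e)) = inj₂ (⟨ false , false , false ⟩ ∷ w' , (tt , tt , tt , le) , v' , cong suc e)
  ... | inj₂ (inj₂ (w' , le , v' , e)) = inj₁ (⟨ true , true , false ⟩ ∷ w' , (tt , tt , tt , le) , v' , cong suc e)

  lower-flat : ∀ {n} (w : Word n) → Valid flat w → 0 < weight w → Lower flat w
  lower-flat (⟨ false , false , false ⟩ ∷ w) v 0<k with lower-flat w v 0<k
  ... | w' , le , v' , e = ⟨ false , false , false ⟩ ∷ w' , (tt , tt , tt , le) , v' , e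
  lower-flat (⟨ false , true , true ⟩ ∷ w) v 0<k with free-split w v
  ... | inj₁ f = ⟨ false , false , false ⟩ ∷ w , (tt , tt , tt , ⊑-refl w) , f , refl
  ... | inj₂ r = ⟨ false , false , true ⟩ ∷ w , (tt , tt , tt , ⊑-refl w) , r , refl
  lower-flat (⟨ false , false , true ⟩ ∷ w) v 0<k with lower-rising w v
  ... | inj₁ (w' , le , v' , e) = ⟨ false , false , true ⟩ ∷ w' , (tt , tt , tt , le) , v' , e
  ... | inj₂ (w' , le , v' , e) = ⟨ false , false , false ⟩ ∷ w' , (tt , tt , tt , le) , v' , e

  lower-free : ∀ {n} (w : Word n) → Valid free w → 0 < weight w → Lower free w
  lower-free w v 0<k with free-split w v
  ... | inj₁ f with lower-flat w f 0<k
  ...   | w' , le , v' , e = w' , le , flat⇒free-valid w' v' , e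
  lower-free w v 0<k | inj₂ r with lower-rising w r
  ... | inj₁ (w' , le , v' , e) = w' , le , rising⇒free-valid w' v' , e
  ... | inj₂ (w' , le , v' , e) = w' , le , flat⇒free-valid w' v' , e

  subword-of-weight : ∀ {n} j (w : Word n) → Valid free w → ∀ {k} → weight w ≡ j + k →
    Σ (Word n) λ w' → w' ⊑ w × Valid free w' × weight w' ≡ k
  subword-of-weight zero    w v e = w , ⊑-refl w , v , e
  subword-of-weight (suc j) w v e with lower-free w v (subst (0 <_) (sym e) (s≤s z≤n))
  ... | w' , le , v' , e' with subword-of-weight j w' v' (suc-injective (trans e' e))
  ...   | w'' , le' , v'' , e'' = w'' , ⊑-trans w'' w' w le' le , v'' , e''

  -- Enumeration of the accepted words

  essentialLetters allLetters : List Letter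
  essentialLetters =
    ⟨ false , false , true ⟩ ∷ ⟨ false , true , false ⟩ ∷ ⟨ false , true , true ⟩ ∷
    ⟨ true , false , true ⟩ ∷ ⟨ true , true , false ⟩ ∷ ⟨ true , true , true ⟩ ∷ []
  -- The two letters without a break come first, so that `count-suc` holds by computation from
  -- `flat`, `rising` and `raised`.
  allLetters = ⟨ false , false , false ⟩ ∷ ⟨ true , false , false ⟩ ∷ essentialLetters

  ∈-allLetters : ∀ ℓ → ℓ ∈ allLetters
  ∈-allLetters ⟨ false , false , false ⟩ = here refl
  ∈-allLetters ⟨ true  , false , false ⟩ = there (here refl)
  ∈-allLetters ⟨ false , false , true  ⟩ = there (there (here refl))
  ∈-allLetters ⟨ false , true  , false ⟩ = there (there (there (here refl)))
  ∈-allLetters ⟨ false , true  , true  ⟩ = there (there (there (there (here refl))))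
  ∈-allLetters ⟨ true  , false , true  ⟩ = there (there (there (there (there (here refl)))))
  ∈-allLetters ⟨ true  , true  , false ⟩ = there (there (there (there (there (there (here refl))))))
  ∈-allLetters ⟨ true  , true  , true  ⟩ = there (there (there (there (there (there (there (here refl)))))))

  unique-allLetters : Unique allLetters
  unique-allLetters =
    ((λ ()) ∷ (λ ()) ∷ (λ ()) ∷ (λ ()) ∷ (λ ()) ∷ (λ ()) ∷ (λ ()) ∷ []) ∷
    ((λ ()) ∷ (λ ()) ∷ (λ ()) ∷ (λ ()) ∷ (λ ()) ∷ (λ ()) ∷ []) ∷
    ((λ ()) ∷ (λ ()) ∷ (λ ()) ∷ (λ ()) ∷ (λ ()) ∷ []) ∷
    ((λ ()) ∷ (λ ()) ∷ (λ ()) ∷ (λ ()) ∷ []) ∷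
    ((λ ()) ∷ (λ ()) ∷ (λ ()) ∷ []) ∷
    ((λ ()) ∷ (λ ()) ∷ []) ∷ ((λ ()) ∷ []) ∷ [] ∷ []

  allWords : ∀ n → List (Word n)
  allWords zero    = [] ∷ []
  allWords (suc n) = concatMap (λ ℓ → List.map (ℓ ∷_) (allWords n)) allLetters

  ∈-prefixed : ∀ {n} (F : Letter → List (Word n)) {ℓ w} ls → ℓ ∈ ls → w ∈ F ℓ → ℓ ∷ w ∈ concatMap (λ ℓ → List.map (ℓ ∷_) (F ℓ)) ls
  ∈-prefixed F (ℓ ∷ ls) (here refl) h = ∈-++⁺ˡ (∈-map⁺ (ℓ ∷_) h)
  ∈-prefixed F (ℓ ∷ ls) (there m)   h = ∈-++⁺ʳ (List.map (ℓ ∷_) (F ℓ)) (∈-prefixed F ls m h)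

  ∈-prefixed⁻ : ∀ {n} (F : Letter → List (Word n)) {ℓ w} ls → ℓ ∷ w ∈ concatMap (λ ℓ → List.map (ℓ ∷_) (F ℓ)) ls → ℓ ∈ ls × w ∈ F ℓ
  ∈-prefixed⁻ F (ℓ ∷ ls) h with ∈-++⁻ (List.map (ℓ ∷_) (F ℓ)) h
  ... | inj₂ t = there (proj₁ (∈-prefixed⁻ F ls t)) , proj₂ (∈-prefixed⁻ F ls t)
  ... | inj₁ t with ∈-map⁻ (ℓ ∷_) t
  ...   | _ , m , refl = here refl , m

  ∈-allWords : ∀ {n} (w : Word n) → w ∈ allWords n
  ∈-allWords []      = here refl
  ∈-allWords (ℓ ∷ w) = ∈-prefixed (λ _ → allWords _) allLetters (∈-allLetters ℓ) (∈-allWords w)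

  unique-prefixed : ∀ {n} (F : Letter → List (Word n)) → (∀ ℓ → Unique (F ℓ)) → ∀ ls → Unique ls →
    Unique (concatMap (λ ℓ → List.map (ℓ ∷_) (F ℓ)) ls)
  unique-prefixed F u []       _        = []
  unique-prefixed F u (ℓ ∷ ls) (h ∷ hs) =
    UniqueP.++⁺ (UniqueP.map⁺ ∷-injectiveʳ (u ℓ)) (unique-prefixed F u ls hs) disjoint
    where
      disjoint : ∀ {w} → w ∈ List.map (ℓ ∷_) (F ℓ) × w ∈ concatMap (λ ℓ → List.map (ℓ ∷_) (F ℓ)) ls → ⊥
      disjoint {ℓ' ∷ w} (p , q) with ∈-map⁻ (ℓ ∷_) p
      ... | _ , _ , refl = All.lookup h (proj₁ (∈-prefixed⁻ F ls q)) refl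

  -- On generating functions this is multiplication by the j-th power of the variable; the default
  -- `z` stands for the coefficients below j.
  shift : {A : Set} → A → (ℕ → A) → ℕ → ℕ → A
  shift z f zero    k       = f k
  shift z f (suc j) zero    = z
  shift z f (suc j) (suc k) = shift z f j k

  ∈-shift : ∀ {A : Set} {x : A} (f : ℕ → List A) j k → x ∈ f k → x ∈ shift [] f j (j + k)
  ∈-shift f zero    k h = h
  ∈-shift f (suc j) k h = ∈-shift f j k h

  ∈-shift⁻ : ∀ {A : Set} {x : A} (f : ℕ → List A) j k → x ∈ shift [] f j k → Σ ℕ λ k' → j + k' ≡ k × x ∈ f k'
  ∈-shift⁻ f zero    k       h = k , refl , h
  ∈-shift⁻ f (suc j) (suc k) h with ∈-shift⁻ f j k h
  ... | k' , e , m = k' , cong suc e , m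

  unique-shift : ∀ {A : Set} (f : ℕ → List A) → (∀ k → Unique (f k)) → ∀ j k → Unique (shift [] f j k)
  unique-shift f u zero    k       = u k
  unique-shift f u (suc j) zero    = []
  unique-shift f u (suc j) (suc k) = unique-shift f u j k

  length-shift : ∀ {A : Set} (f : ℕ → List A) j k → length (shift [] f j k) ≡ shift 0 (λ k → length (f k)) j k
  length-shift f zero    k       = refl
  length-shift f (suc j) zero    = refl
  length-shift f (suc j) (suc k) = length-shift f j k

  shift-cong : ∀ {f g : ℕ → ℕ} → (∀ k → f k ≡ g k) → ∀ j k → shift 0 f j k ≡ shift 0 g j k
  shift-cong e zero    k       = e k
  shift-cong e (suc j) zero    = refl
  shift-cong e (suc j) (suc k) = shift-cong e j k

  shift-zero : ∀ {f : ℕ → ℕ} j k → (∀ k' → j + k' ≡ k → f k' ≡ 0) → shift 0 f j k ≡ 0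
  shift-zero zero    k       h = h k refl
  shift-zero (suc j) zero    h = refl
  shift-zero (suc j) (suc k) h = shift-zero j k (λ k' e → h k' (cong suc e))

  emptyWords : State → ℕ → List (Word 0)
  emptyWords free zero = [] ∷ []
  emptyWords flat zero = [] ∷ []
  emptyWords _    _    = []

  mutual
    words : State → (n k : ℕ) → List (Word n)
    words s zero    k = emptyWords s k
    words s (suc n) k = concatMap (λ ℓ → List.map (ℓ ∷_) (shift [] (wordsFrom (step s ℓ) n) (letterWeight ℓ) k)) allLetters

    wordsFrom : Maybe State → (n k : ℕ) → List (Word n)
    wordsFrom (just s) n k = words s n k
    wordsFrom nothing  n k = []

  mutual
    ∈-words : ∀ {n} s (w : Word n) → Valid s w → w ∈ words s n (weight w)
    ∈-words free []      v = here refl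
    ∈-words flat []      v = here refl
    ∈-words s    (ℓ ∷ w) v =
      ∈-prefixed (λ ℓ' → shift [] (wordsFrom (step s ℓ') _) (letterWeight ℓ') (letterWeight ℓ + weight w)) allLetters (∈-allLetters ℓ)
        (∈-shift (wordsFrom (step s ℓ) _) (letterWeight ℓ) (weight w) (∈-wordsFrom (step s ℓ) w v))

    ∈-wordsFrom : ∀ {n} m (w : Word n) → ValidFrom m w → w ∈ wordsFrom m n (weight w)
    ∈-wordsFrom (just s) w v = ∈-words s w v

  mutual
    words-valid : ∀ {n} s (w : Word n) k → w ∈ words s n k → Valid s w × weight w ≡ k
    words-valid free [] zero h = tt , refl
    words-valid flat [] zero h = tt , refl
    words-valid s (ℓ ∷ w) k h
      with ∈-shift⁻ (wordsFrom (step s ℓ) _) (letterWeight ℓ) k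
             (proj₂ (∈-prefixed⁻ (λ ℓ → shift [] (wordsFrom (step s ℓ) _) (letterWeight ℓ) k) allLetters h))
    ... | k' , refl , m with wordsFrom-valid (step s ℓ) w k' m
    ...   | v , refl = v , refl

    wordsFrom-valid : ∀ {n} m (w : Word n) k → w ∈ wordsFrom m n k → ValidFrom m w × weight w ≡ k
    wordsFrom-valid (just s) w k h = words-valid s w k h

  mutual
    unique-words : ∀ s n k → Unique (words s n k)
    unique-words free   zero    zero    = [] ∷ []
    unique-words flat   zero    zero    = [] ∷ []
    unique-words rising zero    zero    = []
    unique-words raised zero    zero    = []
    unique-words free   zero    (suc k) = []
    unique-words flat   zero    (suc k) = []
    unique-words rising zero    (suc k) = []
    unique-words raised zero    (suc k) = []
    unique-words s (suc n) k =
      unique-prefixed (λ ℓ → shift [] (wordsFrom (step s ℓ) n) (letterWeight ℓ) k)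
        (λ ℓ → unique-shift (wordsFrom (step s ℓ) n) (unique-wordsFrom (step s ℓ) n) (letterWeight ℓ) k) allLetters unique-allLetters

    unique-wordsFrom : ∀ m n k → Unique (wordsFrom m n k)
    unique-wordsFrom (just s) n k = unique-words s n k
    unique-wordsFrom nothing  n k = []

  -- Counting words by the binomial transform

  start : State → ℕ → ℕ
  start s k = length (emptyWords s k)

  letterSum : List Letter → (Maybe State → ℕ → ℕ) → State → ℕ → ℕ
  letterSum ls X s k = sum (List.map (λ ℓ → shift 0 (X (step s ℓ)) (letterWeight ℓ) k) ls)

  orZero : (State → ℕ → ℕ) → Maybe State → ℕ → ℕ
  orZero f (just s) k = f s k
  orZero f nothing  k = 0

  count reduced : ℕ → State → ℕ → ℕ
  count zero    s k = start s k
  count (suc n) s k = letterSum allLetters (orZero (count n)) s k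
  reduced zero    s k = start s k
  reduced (suc n) s k = letterSum essentialLetters (orZero (reduced n)) s k

  length-prefixed : ∀ {n} (F : Letter → List (Word n)) (g : Letter → ℕ) → (∀ ℓ → length (F ℓ) ≡ g ℓ) → ∀ ls →
    length (concatMap (λ ℓ → List.map (ℓ ∷_) (F ℓ)) ls) ≡ sum (List.map g ls)
  length-prefixed F g e []       = refl
  length-prefixed F g e (ℓ ∷ ls) = trans (length-++ (List.map (ℓ ∷_) (F ℓ)))
    (cong₂ _+_ (trans (length-map (ℓ ∷_) (F ℓ)) (e ℓ)) (length-prefixed F g e ls))

  mutual
    length-words : ∀ n s k → length (words s n k) ≡ count n s k
    length-words zero    s k = refl
    length-words (suc n) s k = length-prefixed
      (λ ℓ → shift [] (wordsFrom (step s ℓ) n) (letterWeight ℓ) k) (λ ℓ → shift 0 (orZero (count n) (step s ℓ)) (letterWeight ℓ) k)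
      (λ ℓ → trans (length-shift (wordsFrom (step s ℓ) n) (letterWeight ℓ) k) (shift-cong (length-wordsFrom n (step s ℓ)) (letterWeight ℓ) k)) allLetters

    length-wordsFrom : ∀ n m k → length (wordsFrom m n k) ≡ orZero (count n) m k
    length-wordsFrom n (just s) k = length-words n s k
    length-wordsFrom n nothing  k = refl

  sum-map-+ : ∀ {A : Set} {f g h : A → ℕ} → (∀ x → f x ≡ g x + h x) → ∀ xs →
    sum (List.map f xs) ≡ sum (List.map g xs) + sum (List.map h xs)
  sum-map-+ e [] = refl
  sum-map-+ {f = f} {g} {h} e (x ∷ xs) = trans (cong₂ _+_ (e x) (sum-map-+ e xs)) (lem (g x) (h x) _ _)
    where
      lem : ∀ a b c d → a + b + (c + d) ≡ a + c + (b + d)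
      lem = solve-∀

  sum-map-cong : ∀ {A : Set} {f g : A → ℕ} → (∀ x → f x ≡ g x) → ∀ xs → sum (List.map f xs) ≡ sum (List.map g xs)
  sum-map-cong e []       = refl
  sum-map-cong e (x ∷ xs) = cong₂ _+_ (e x) (sum-map-cong e xs)

  sum-map-zero : ∀ {A : Set} {f : A → ℕ} xs → (∀ x → x ∈ xs → f x ≡ 0) → sum (List.map f xs) ≡ 0
  sum-map-zero []       e = refl
  sum-map-zero (x ∷ xs) e = cong₂ _+_ (e x (here refl)) (sum-map-zero xs (λ y m → e y (there m)))

  -- The flag `off` of the next letter reveals whether the slope at this zero of D is zero or
  -- positive; the empty word belongs to `flat` alone.
  count-free : ∀ n k → count n free k ≡ count n flat k + count n rising k
  count-free zero zero    = refl
  count-free zero (suc k) = refl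
  count-free (suc n) k = sum-map-+ {g = branch flat} {branch rising} split allLetters
    where
      branch : State → Letter → ℕ
      branch s ℓ = shift 0 (orZero (count n) (step s ℓ)) (letterWeight ℓ) k
      none : ∀ j → shift 0 (orZero (count n) nothing) j k ≡ 0
      none j = shift-zero j k (λ _ _ → refl)
      split : ∀ ℓ → branch free ℓ ≡ branch flat ℓ + branch rising ℓ
      split ℓ@(⟨ false , a , b ⟩) = sym (trans (cong (branch flat ℓ +_) (none (bit (a ∧ b)))) (+-identityʳ (branch flat ℓ)))
      split ℓ@(⟨ true  , a , b ⟩) = sym (cong (_+ branch rising ℓ) (none (bit a + bit b)))

  -- The letters ⟨ _ , false , false ⟩ keep the state, except that from `free` they lead to `flat` or `rising`, whose counts add up to that of `free`.
  count-suc : ∀ n s k → count (suc n) s k ≡ count n s k + letterSum essentialLetters (orZero (count n)) s k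
  count-suc n flat   k = refl
  count-suc n rising k = refl
  count-suc n raised k = refl
  count-suc n free   k = trans (sym (+-assoc (count n flat k) _ _)) (cong (_+ letterSum essentialLetters (orZero (count n)) free k) (sym (count-free n k)))

  -- By Pascal's rule this is the sum over j of (n choose j) times `h j`. The recursive form matches
  -- a case distinction on whether the first letter is trivial or essential.
  binomialTransform : (ℕ → ℕ) → ℕ → ℕ
  binomialTransform h zero    = h 0
  binomialTransform h (suc n) = binomialTransform h n + binomialTransform (λ j → h (suc j)) n

  bt-zero : ∀ {h} n → (∀ j → j ≤ n → h j ≡ 0) → binomialTransform h n ≡ 0
  bt-zero zero    e = e 0 z≤n
  bt-zero (suc n) e = cong₂ _+_ (bt-zero n (λ j le → e j (m≤n⇒m≤1+n le))) (bt-zero n (λ j le → e (suc j) (s≤s le)))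

  bt-top : ∀ {h} n → (∀ j → j < n → h j ≡ 0) → binomialTransform h n ≡ h n
  bt-top zero    e = refl
  bt-top (suc n) e = cong₂ _+_ (bt-zero n (λ j le → e j (s≤s le))) (bt-top n (λ j lt → e (suc j) (s≤s lt)))

  bt-+ : ∀ f g n → binomialTransform (λ j → f j + g j) n ≡ binomialTransform f n + binomialTransform g n
  bt-+ f g zero    = refl
  bt-+ f g (suc n) = trans (cong₂ _+_ (bt-+ f g n) (bt-+ (λ j → f (suc j)) (λ j → g (suc j)) n)) (lem (binomialTransform f n) _ _ _)
    where
      lem : ∀ a b c d → a + b + (c + d) ≡ a + c + (b + d)
      lem = solve-∀

  bt-sum : ∀ {A : Set} (H : A → ℕ → ℕ) n xs →
    binomialTransform (λ j → sum (List.map (λ x → H x j) xs)) n ≡ sum (List.map (λ x → binomialTransform (H x) n) xs)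
  bt-sum H n []       = bt-zero n (λ _ _ → refl)
  bt-sum H n (x ∷ xs) = trans (bt-+ (H x) _ n) (cong (binomialTransform (H x) n +_) (bt-sum H n xs))

  bt-shift : ∀ (X : ℕ → ℕ → ℕ) n i k →
    shift 0 (λ k → binomialTransform (λ j → X j k) n) i k ≡ binomialTransform (λ j → shift 0 (X j) i k) n
  bt-shift X n zero    k       = refl
  bt-shift X n (suc i) zero    = sym (bt-zero n (λ _ _ → refl))
  bt-shift X n (suc i) (suc k) = bt-shift X n i k

  -- The transform is additive in `h`, so it commutes with the sum over letters and with `shift`.
  -- Under it `count-suc` becomes the defining recursion: a trivial first letter leaves `reduced` as
  -- it is, an essential one shifts its length by one.
  count≡bt : ∀ n s k → count n s k ≡ binomialTransform (λ j → reduced j s k) n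
  count≡bt zero    s k = refl
  count≡bt (suc n) s k = trans (count-suc n s k) (cong₂ _+_ (count≡bt n s k)
    (trans (sum-map-cong (λ ℓ → trans (shift-cong (lift (step s ℓ)) (letterWeight ℓ) k)
                                      (bt-shift (λ j → orZero (reduced j) (step s ℓ)) n (letterWeight ℓ) k)) essentialLetters)
           (sym (bt-sum (λ ℓ j → shift 0 (orZero (reduced j) (step s ℓ)) (letterWeight ℓ) k) n essentialLetters))))
    where
      lift : ∀ m k → orZero (count n) m k ≡ binomialTransform (λ j → orZero (reduced j) m k) n
      lift (just s') k = count≡bt n s' k
      lift nothing   k = sym (bt-zero n (λ _ _ → refl))

  -- Length bounds for words without trivial positions

  module Vanishing (Bad : State → ℕ → ℕ → Set)
    (base : ∀ s k → Bad s 0 k → start s k ≡ 0)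
    (next : ∀ s ℓ s' n k' → ℓ ∈ essentialLetters → step s ℓ ≡ just s' → Bad s (suc n) (letterWeight ℓ + k') → Bad s' n k') where

    -- `Bad` is inherited along every transition and excludes acceptance of the empty word, so no
    -- accepted word can start in it.
    reduced-vanish : ∀ n s k → Bad s n k → reduced n s k ≡ 0
    reduced-vanish zero    s k bad = base s k bad
    reduced-vanish (suc n) s k bad = sum-map-zero essentialLetters (λ ℓ m → shift-zero (letterWeight ℓ) k
      (λ k' e → go ℓ m k' (step s ℓ) refl (subst (Bad s (suc n)) (sym e) bad)))
      where
        go : ∀ ℓ → ℓ ∈ essentialLetters → ∀ k' m → step s ℓ ≡ m → Bad s (suc n) (letterWeight ℓ + k') → orZero (reduced n) m k' ≡ 0
        go ℓ mem k' (just s') e bad = reduced-vanish n s' k' (next s ℓ s' n k' mem e bad)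
        go ℓ mem k' nothing   e bad = refl

  -- Every accepted word of weight k read from s without ⟨ _ , false , false ⟩ letters is shorter than 3k + potential s.
  potential : State → ℕ
  potential rising = 0
  potential flat   = 1
  potential free   = 1
  potential raised = 2

  tooLong : State → ℕ → ℕ → Set
  tooLong s n k = 3 * k + potential s ≤ n

  tooLong-base : ∀ s k → tooLong s 0 k → start s k ≡ 0
  tooLong-base rising zero    h = refl
  tooLong-base rising (suc k) h = refl
  tooLong-base raised zero    h = refl
  tooLong-base raised (suc k) h = refl
  tooLong-base free   (suc k) h = refl
  tooLong-base flat   (suc k) h = refl

  -- The rate 3 is that of the loop `⟨ false , false , true ⟩`, `⟨ true , true , false ⟩`,
  -- `⟨ false , false , true ⟩` from `free` to itself, where only the middle letter has weight. The
  -- potential drops by one at each weightless letter and rises by at most two at the others.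
  tooLong-next : ∀ s ℓ s' n k' → ℓ ∈ essentialLetters → step s ℓ ≡ just s' → tooLong s (suc n) (letterWeight ℓ + k') → tooLong s' n k'
  tooLong-next s ℓ s' n k' mem e h = ℕ.s≤s⁻¹ (≤-trans (subst₂ _≤_ (+-suc (3 * k') (potential s')) (lem (letterWeight ℓ) k' (potential s))
      (+-monoʳ-≤ (3 * k') (gain s ℓ mem e))) h)
    where
      lem : ∀ c k p → 3 * k + (3 * c + p) ≡ 3 * (c + k) + p
      lem = solve-∀
      gain : ∀ s ℓ {s'} → ℓ ∈ essentialLetters → step s ℓ ≡ just s' → suc (potential s') ≤ 3 * letterWeight ℓ + potential s
      gain s ⟨ false , false , false ⟩ (there (there (there (there (there (there ())))))) e
      gain s ⟨ true , false , false ⟩ (there (there (there (there (there (there ())))))) e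
      gain flat   ⟨ false , true  , true  ⟩ m refl = s≤s (s≤s z≤n)
      gain flat   ⟨ false , false , true  ⟩ m refl = s≤s z≤n
      gain free   ⟨ false , true  , true  ⟩ m refl = s≤s (s≤s z≤n)
      gain free   ⟨ false , false , true  ⟩ m refl = s≤s z≤n
      gain free   ⟨ true  , true  , true  ⟩ m refl = s≤s (s≤s (s≤s z≤n))
      gain free   ⟨ true  , true  , false ⟩ m refl = s≤s (s≤s (s≤s z≤n))
      gain free   ⟨ true  , false , true  ⟩ m refl = s≤s z≤n
      gain rising ⟨ true  , true  , true  ⟩ m refl = s≤s (s≤s (s≤s z≤n))
      gain rising ⟨ true  , true  , false ⟩ m refl = s≤s (s≤s (s≤s z≤n))
      gain rising ⟨ true  , false , true  ⟩ m refl = s≤s z≤n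
      gain raised ⟨ true  , true  , true  ⟩ m refl = s≤s (s≤s (s≤s z≤n))
      gain raised ⟨ true  , true  , false ⟩ m refl = s≤s (s≤s (s≤s z≤n))
      gain raised ⟨ true  , false , true  ⟩ m refl = s≤s (s≤s (s≤s z≤n))
      gain raised ⟨ false , true  , true  ⟩ m refl = s≤s (s≤s z≤n)
      gain raised ⟨ false , false , true  ⟩ m refl = s≤s (s≤s z≤n)

  open Vanishing tooLong tooLong-base tooLong-next public using () renaming (reduced-vanish to reduced-tooLong)

  -- The empty word has weight 0 and is accepted from flat and free, so these states need the extra bound k ≥ 1.
  floor : State → ℕ
  floor rising = 0
  floor raised = 0
  floor flat   = 1
  floor free   = 1

  tooHeavy : State → ℕ → ℕ → Set
  tooHeavy s n k = 2 * n ≤ k × floor s ≤ k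

  tooHeavy-base : ∀ s k → tooHeavy s 0 k → start s k ≡ 0
  tooHeavy-base rising zero    h = refl
  tooHeavy-base rising (suc k) h = refl
  tooHeavy-base raised zero    h = refl
  tooHeavy-base raised (suc k) h = refl
  tooHeavy-base free   (suc k) h = refl
  tooHeavy-base flat   (suc k) h = refl

  -- A letter weighs at most two, which preserves the first bound. A letter that leads to `flat` or
  -- `free` sits at a zero of D and weighs at most one, so at least one unit of weight is left over
  -- for `floor`.
  tooHeavy-next : ∀ s ℓ s' n k' → ℓ ∈ essentialLetters → step s ℓ ≡ just s' → tooHeavy s (suc n) (letterWeight ℓ + k') → tooHeavy s' n k'
  tooHeavy-next s ℓ s' n k' _ e (h , _) =
    +-cancelˡ-≤ 2 _ _ (≤-trans 2+2n≤ (+-monoˡ-≤ k' (letterWeight≤2 ℓ))) , positive s ℓ e 2+2n≤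
    where
      2+2n≤ : 2 + 2 * n ≤ letterWeight ℓ + k'
      2+2n≤ = subst (_≤ letterWeight ℓ + k') (*-suc 2 n) h
      letterWeight≤2 : ∀ ℓ → letterWeight ℓ ≤ 2
      letterWeight≤2 ⟨ false , false , b     ⟩ = z≤n
      letterWeight≤2 ⟨ false , true  , true  ⟩ = s≤s z≤n
      letterWeight≤2 ⟨ false , true  , false ⟩ = z≤n
      letterWeight≤2 ⟨ true  , false , true  ⟩ = s≤s z≤n
      letterWeight≤2 ⟨ true  , false , false ⟩ = z≤n
      letterWeight≤2 ⟨ true  , true  , true  ⟩ = s≤s (s≤s z≤n)
      letterWeight≤2 ⟨ true  , true  , false ⟩ = s≤s z≤n
      positive : ∀ s ℓ {s'} → step s ℓ ≡ just s' → 2 + 2 * n ≤ letterWeight ℓ + k' → floor s' ≤ k'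
      positive flat   ⟨ false , true  , true  ⟩ refl (s≤s (s≤s h)) = s≤s z≤n
      positive free   ⟨ false , true  , true  ⟩ refl (s≤s (s≤s h)) = s≤s z≤n
      positive flat   ⟨ false , false , true  ⟩ refl h = z≤n
      positive free   ⟨ false , false , true  ⟩ refl h = z≤n
      positive flat   ⟨ false , false , false ⟩ refl (s≤s h) = s≤s z≤n
      positive free   ⟨ false , false , false ⟩ refl (s≤s h) = s≤s z≤n
      positive free   ⟨ true  , true  , b     ⟩ refl h = z≤n
      positive free   ⟨ true  , false , b     ⟩ refl h = z≤n
      positive rising ⟨ true  , true  , b     ⟩ refl h = z≤n
      positive rising ⟨ true  , false , b     ⟩ refl h = z≤n
      positive raised ⟨ true  , a     , b     ⟩ refl h = z≤n
      positive raised ⟨ false , true  , true  ⟩ refl (s≤s (s≤s h)) = s≤s z≤n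
      positive raised ⟨ false , false , true  ⟩ refl (s≤s h) = s≤s z≤n

  open Vanishing tooHeavy tooHeavy-base tooHeavy-next public using () renaming (reduced-vanish to reduced-tooHeavy)

  -- Counts at the two largest weights of a given length

  double : ℕ → ℕ
  double zero    = 0
  -- Exposing two successors at once lets `shift` compute here; `2 * suc m` would expose only one.
  double (suc m) = suc (suc (double m))

  double≡ : ∀ m → double m ≡ 2 * m
  double≡ zero    = refl
  double≡ (suc m) = trans (cong (λ z → suc (suc z)) (double≡ m)) (sym (*-suc 2 m))

  module _ (m : ℕ) where
    private
      heavy : ∀ s k → reduced (suc m) s (suc (suc (k + double m))) ≡ 0
      heavy s k = reduced-tooHeavy (suc m) s _
        (subst (_≤ suc (suc (k + double m))) (double≡ (suc m)) (s≤s (s≤s (m≤n+m (double m) k))) , floor≤ s)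
        where
          floor≤ : ∀ s {k} → floor s ≤ suc k
          floor≤ rising = z≤n
          floor≤ raised = z≤n
          floor≤ flat   = s≤s z≤n
          floor≤ free   = s≤s z≤n

    reduced-raised-suc : reduced (suc (suc m)) raised (suc (double (suc m))) ≡ reduced (suc m) raised (suc (double m))
    reduced-raised-suc rewrite heavy free 1 | heavy free 0 | heavy raised 0 = +-identityʳ _

    reduced-rising-suc : reduced (suc (suc m)) rising (suc (double (suc m))) ≡ reduced (suc m) raised (suc (double m))
    reduced-rising-suc rewrite heavy rising 0 | heavy raised 0 = +-identityʳ _

    reduced-free-suc : reduced (suc (suc m)) free (suc (double (suc m))) ≡ reduced (suc m) raised (suc (double m))
    reduced-free-suc rewrite heavy rising 1 | heavy free 0 | heavy rising 0 | heavy raised 0 = +-identityʳ _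

    reduced-raised-double-suc : reduced (suc (suc m)) raised (double (suc m)) ≡
      reduced (suc m) free (suc (double m)) + (reduced (suc m) raised (suc (double m)) + (reduced (suc m) raised (suc (double m)) + reduced (suc m) raised (double m)))
    reduced-raised-double-suc rewrite heavy free 0 | +-identityʳ (reduced (suc m) raised (double m)) = refl

    reduced-free-double-suc : reduced (suc (suc m)) free (double (suc m)) ≡
      reduced (suc m) free (suc (double m)) + (reduced (suc m) rising (suc (double m)) + (reduced (suc m) raised (suc (double m)) + reduced (suc m) raised (double m)))
    reduced-free-double-suc rewrite heavy rising 0 | +-identityʳ (reduced (suc m) raised (double m)) = refl

  -- At maximal weight every letter but the last weighs two, which leaves `⟨ true , true , true ⟩`
  -- repeated m times and a final `⟨ false , true , true ⟩`.
  reduced-raised-top : ∀ m → reduced (suc m) raised (suc (double m)) ≡ 1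
  reduced-raised-top zero    = refl
  reduced-raised-top (suc m) = trans (reduced-raised-suc m) (reduced-raised-top m)

  reduced-rising-top : ∀ m → reduced (suc (suc m)) rising (suc (double (suc m))) ≡ 1
  reduced-rising-top m = trans (reduced-rising-suc m) (reduced-raised-top m)

  reduced-free-top : ∀ m → reduced (suc m) free (suc (double m)) ≡ 1
  reduced-free-top zero    = refl
  reduced-free-top (suc m) = trans (reduced-free-suc m) (reduced-raised-top m)

  -- One unit below the maximum is lost either at one of the first m letters, in three ways (one
  -- flag of `⟨ true , true , true ⟩` is cleared), or at the last letter, in one way.
  reduced-raised-double : ∀ m → reduced (suc m) raised (double m) ≡ suc (3 * m)
  reduced-raised-double zero    = refl
  reduced-raised-double (suc m) = trans (reduced-raised-double-suc m)
    (trans (cong₂ _+_ (reduced-free-top m) (cong₂ _+_ (reduced-raised-top m) (cong₂ _+_ (reduced-raised-top m) (reduced-raised-double m)))) (lem m))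
    where
      lem : ∀ m → 1 + (1 + (1 + suc (3 * m))) ≡ suc (3 * suc m)
      lem = solve-∀

  -- From `free` the letter `⟨ true , false , true ⟩` leads to `rising`, from where at least two
  -- more letters are needed. At total length two this option is missing, which is why d = 1 has the
  -- value 3 instead of 4.
  reduced-free-double : ∀ m → reduced (suc (suc (suc m))) free (double (suc (suc m))) ≡ 3 * m + 7
  reduced-free-double m = trans (reduced-free-double-suc (suc m))
    (trans (cong₂ _+_ (reduced-free-top (suc m)) (cong₂ _+_ (reduced-rising-top m) (cong₂ _+_ (reduced-raised-top (suc m)) (reduced-raised-double (suc m))))) (lem m))
    where
      lem : ∀ m → 1 + (1 + (1 + suc (3 * suc m))) ≡ 3 * m + 7
      lem = solve-∀

open Words

module Geometry where

  open import Data.Fin as Fin using (Fin; zero; suc; punchIn)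
  open import Data.Fin.Properties using (any?)
  open import Data.Rational as ℚ using (ℚ; 0ℚ; 1ℚ; mkℚ; _+_; _*_; _-_; -_; _≤_; _<_; _⊔_; 1/_; ≢-nonZero; nonNegative; positive; toℚᵘ)
  open import Data.Rational.Properties
  open import Data.Rational.Solver using (module +-*-Solver)
  open import Data.Rational.Unnormalised as ℚᵘ using (mkℚᵘ; *≡*)
  import Data.Rational.Unnormalised.Properties as ℚᵘP
  open import Data.Vec.Functional using (insertAt)
  open import Data.Vec.Functional.Properties using (insertAt-lookup; insertAt-punchIn)
  open import Relation.Binary.Definitions using (tri<; tri≈; tri>)
  open import Relation.Nullary.Decidable using (decidable-stable)
  open +-*-Solver using (solve; _:+_; _:*_; _:-_; :-_; _:=_; con)

  -- Rational arithmetic and finite sums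

  0<1 : 0ℚ < 1ℚ
  0<1 = positive⁻¹ 1ℚ

  +-nonneg : ∀ {p q} → 0ℚ ≤ p → 0ℚ ≤ q → 0ℚ ≤ p + q
  +-nonneg = +-mono-≤

  +-pos : ∀ {p q} → 0ℚ < p → 0ℚ < q → 0ℚ < p + q
  +-pos = +-mono-<

  +-pos-nonneg : ∀ {p q} → 0ℚ < p → 0ℚ ≤ q → 0ℚ < p + q
  +-pos-nonneg = +-mono-<-≤

  +-nonneg-pos : ∀ {p q} → 0ℚ ≤ p → 0ℚ < q → 0ℚ < p + q
  +-nonneg-pos = +-mono-≤-<

  *-nonneg : ∀ {p q} → 0ℚ ≤ p → 0ℚ ≤ q → 0ℚ ≤ p * q
  *-nonneg {p} {q} 0≤p 0≤q = subst (_≤ p * q) (*-zeroʳ p) (*-monoˡ-≤-nonNeg p {{nonNegative 0≤p}} 0≤q)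

  *-pos : ∀ {p q} → 0ℚ < p → 0ℚ < q → 0ℚ < p * q
  *-pos {p} {q} 0<p 0<q = subst (_< p * q) (*-zeroʳ p) (*-monoʳ-<-pos p {{positive 0<p}} 0<q)

  ≤⇒0≤- : ∀ {p q} → p ≤ q → 0ℚ ≤ q - p
  ≤⇒0≤- {p} {q} p≤q = subst (_≤ q - p) (+-inverseʳ p) (+-monoˡ-≤ (- p) p≤q)

  0≤-⇒≤ : ∀ {p q} → 0ℚ ≤ q - p → p ≤ q
  0≤-⇒≤ {p} {q} h = subst₂ _≤_ (+-identityˡ p) (solve 2 (λ p q → q :- p :+ p := q) refl p q) (+-monoˡ-≤ p h)

  neg-nonpos : ∀ {p} → 0ℚ ≤ p → - p ≤ 0ℚ
  neg-nonpos = neg-antimono-≤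

  nonneg-neg-zero : ∀ {p} → 0ℚ ≤ p → 0ℚ ≤ - p → p ≡ 0ℚ
  nonneg-neg-zero {p} 0≤p 0≤-p =
    ≤-antisym (subst (_≤ 0ℚ) (solve 1 (λ p → :- (:- p) := p) refl p) (neg-nonpos 0≤-p)) 0≤p

  +-zero-left : ∀ {p q} → 0ℚ ≤ p → 0ℚ ≤ q → p + q ≡ 0ℚ → p ≡ 0ℚ
  +-zero-left {p} {q} 0≤p 0≤q e =
    nonneg-neg-zero 0≤p (subst (0ℚ ≤_) (trans (solve 2 (λ p q → q := p :+ q :- p) refl p q) (trans (cong (_- p) e) (+-identityˡ (- p)))) 0≤q)

  +-zero-right : ∀ {p q} → 0ℚ ≤ p → 0ℚ ≤ q → p + q ≡ 0ℚ → q ≡ 0ℚ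
  +-zero-right {p} {q} 0≤p 0≤q e = +-zero-left 0≤q 0≤p (trans (+-comm q p) e)

  recip : (p : ℚ) → p ≢ 0ℚ → Σ ℚ λ q → q * p ≡ 1ℚ
  recip p p≢0 = (1/ p) {{≢-nonZero p≢0}} , *-inverseˡ p {{≢-nonZero p≢0}}

  recip-pos : (p : ℚ) → 0ℚ < p → Σ ℚ λ q → q * p ≡ 1ℚ × 0ℚ < q
  recip-pos p 0<p =
    (1/ p) {{nz}} , *-inverseˡ p {{nz}} , positive⁻¹ ((1/ p) {{nz}}) {{1/pos⇒pos p {{positive 0<p}}}}
    where
      nz = pos⇒nonZero p {{positive 0<p}}

  *-zero-cancelˡ : ∀ {p q} → p ≢ 0ℚ → p * q ≡ 0ℚ → q ≡ 0ℚ
  *-zero-cancelˡ {p} {q} p≢0 e with recip p p≢0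
  ... | i , ip≡1 = trans (sym (*-identityˡ q)) (trans (cong (_* q) (sym ip≡1)) (trans (*-assoc i p q) (trans (cong (i *_) e) (*-zeroʳ i))))

  pos⇒≢0 : ∀ {p} → 0ℚ < p → p ≢ 0ℚ
  pos⇒≢0 0<p p≡0 = <⇒≢ 0<p (sym p≡0)

  +-interchange : ∀ a b c d → a + b + (c + d) ≡ a + c + (b + d)
  +-interchange = solve 4 (λ a b c d → a :+ b :+ (c :+ d) := a :+ c :+ (b :+ d)) refl

  sum-cong : ∀ n {f g : Fin n → ℚ} → (∀ i → f i ≡ g i) → sumℚ n f ≡ sumℚ n g
  sum-cong zero    e = refl
  sum-cong (suc n) e = cong₂ _+_ (e zero) (sum-cong n (λ i → e (suc i)))

  sum-zero : ∀ n {f : Fin n → ℚ} → (∀ i → f i ≡ 0ℚ) → sumℚ n f ≡ 0ℚ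
  sum-zero zero    e = refl
  sum-zero (suc n) e = trans (cong₂ _+_ (e zero) (sum-zero n (λ i → e (suc i)))) (+-identityˡ 0ℚ)

  sum-+ : ∀ n (f g : Fin n → ℚ) → sumℚ n (λ i → f i + g i) ≡ sumℚ n f + sumℚ n g
  sum-+ zero    f g = refl
  sum-+ (suc n) f g = trans (cong (f zero + g zero +_) (sum-+ n _ _))
    (+-interchange (f zero) (g zero) (sumℚ n (λ i → f (suc i))) (sumℚ n (λ i → g (suc i))))

  sum-*ˡ : ∀ n c (f : Fin n → ℚ) → sumℚ n (λ i → c * f i) ≡ c * sumℚ n f
  sum-*ˡ zero    c f = sym (*-zeroʳ c)
  sum-*ˡ (suc n) c f = trans (cong (c * f zero +_) (sum-*ˡ n c _)) (sym (*-distribˡ-+ c (f zero) _))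

  sum-swap : ∀ m n (f : Fin m → Fin n → ℚ) →
    sumℚ m (λ i → sumℚ n (f i)) ≡ sumℚ n (λ j → sumℚ m (λ i → f i j))
  sum-swap zero    n f = sym (sum-zero n (λ _ → refl))
  sum-swap (suc m) n f = trans (cong (sumℚ n (f zero) +_) (sum-swap m n (λ i → f (suc i)))) (sym (sum-+ n _ _))

  sum-nonneg : ∀ n {f : Fin n → ℚ} → (∀ i → 0ℚ ≤ f i) → 0ℚ ≤ sumℚ n f
  sum-nonneg zero    h = ≤-refl
  sum-nonneg (suc n) h = +-nonneg (h zero) (sum-nonneg n (λ i → h (suc i)))

  sum-*-lincomb : ∀ r k (c : Fin r → ℚ) (t : Fin k → ℚ) (v : Fin k → Fin r → ℚ) →
    sumℚ r (λ j → c j * sumℚ k (λ i → t i * v i j)) ≡ sumℚ k (λ i → t i * sumℚ r (λ j → c j * v i j))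
  sum-*-lincomb r k c t v =
    trans (sum-cong r (λ j → sym (sum-*ˡ k (c j) _)))
    (trans (sum-swap r k _)
    (sum-cong k (λ i → trans (sum-cong r (λ j → solve 3 (λ x y z → x :* (y :* z) := y :* (x :* z)) refl (c j) (t i) (v i j)))
                             (sum-*ˡ r (t i) _))))

  -- Points and linear functionals

  addP : ∀ {r} → Point r → Point r → Point r
  addP (x , y) (x' , y') = (λ i → x i + x' i) , (λ i → y i + y' i)

  scaleP : ∀ {r} → ℚ → Point r → Point r
  scaleP t (x , y) = (λ i → t * x i) , (λ i → t * y i)

  tailP : ∀ {r} → Point (suc r) → Point r
  tailP (x , y) = (λ i → x (suc i)) , (λ i → y (suc i))

  consF : ∀ {r} → ℚ → (Fin r → ℚ) → Fin (suc r) → ℚ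
  consF q f zero    = q
  consF q f (suc i) = f i

  consP : ∀ {r} → ℚ → ℚ → Point r → Point (suc r)
  consP p q (x , y) = consF p x , consF q y

  -- Functionals are defined by recursion along a point, whereas faces are given by coefficient
  -- vectors. The vector is therefore carried as data, and `normal` reads it off.
  IsLinear : ∀ {r} → (Point r → ℚ) → Set
  IsLinear {r} g = Σ (Point r) λ c → ∀ x → dot r c x ≡ g x

  dot-cong : ∀ r c {x y} → x ≈P y → dot r c x ≡ dot r c y
  dot-cong r (c , e) (p , q) =
    cong₂ _+_ (sum-cong r (λ i → cong (c i *_) (p i))) (sum-cong r (λ i → cong (e i *_) (q i)))

  dot-lincomb : ∀ r c k t v → dot r c (lincomb r k t v) ≡ sumℚ k (λ i → t i * dot r c (v i))
  dot-lincomb r (c , e) k t v =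
    trans (cong₂ _+_ (sum-*-lincomb r k c t (λ i → proj₁ (v i))) (sum-*-lincomb r k e t (λ i → proj₂ (v i))))
    (trans (sym (sum-+ k _ _)) (sum-cong k (λ i → sym (*-distribˡ-+ (t i) _ _))))

  sum-*-add : ∀ r (c x y : Fin r → ℚ) → sumℚ r (λ j → c j * (x j + y j)) ≡ sumℚ r (λ j → c j * x j) + sumℚ r (λ j → c j * y j)
  sum-*-add r c x y = trans (sum-cong r (λ j → *-distribˡ-+ (c j) (x j) (y j))) (sum-+ r _ _)

  dot-add : ∀ r c x y → dot r c (addP x y) ≡ dot r c x + dot r c y
  dot-add r (c , e) (x , y) (x' , y') =
    trans (cong₂ _+_ (sum-*-add r c x x') (sum-*-add r e y y'))
    (+-interchange (sumℚ r (λ j → c j * x j)) (sumℚ r (λ j → c j * x' j)) (sumℚ r (λ j → e j * y j)) (sumℚ r (λ j → e j * y' j)))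

  sum-*-scale : ∀ r t (c x : Fin r → ℚ) → sumℚ r (λ j → c j * (t * x j)) ≡ t * sumℚ r (λ j → c j * x j)
  sum-*-scale r t c x =
    trans (sum-cong r (λ j → solve 3 (λ x y z → x :* (y :* z) := y :* (x :* z)) refl (c j) t (x j))) (sum-*ˡ r t _)

  dot-scale : ∀ r c t x → dot r c (scaleP t x) ≡ t * dot r c x
  dot-scale r (c , e) t (x , y) =
    trans (cong₂ _+_ (sum-*-scale r t c x) (sum-*-scale r t e y)) (sym (*-distribˡ-+ t _ _))

  module _ {r : ℕ} {g : Point r → ℚ} (lin : IsLinear g) where

    linear-cong : ∀ {x y} → x ≈P y → g x ≡ g y
    linear-cong {x} {y} e = trans (sym (proj₂ lin x)) (trans (dot-cong r (proj₁ lin) e) (proj₂ lin y))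

    linear-lincomb : ∀ k t v → g (lincomb r k t v) ≡ sumℚ k (λ i → t i * g (v i))
    linear-lincomb k t v = trans (sym (proj₂ lin _))
      (trans (dot-lincomb r (proj₁ lin) k t v) (sum-cong k (λ i → cong (t i *_) (proj₂ lin (v i)))))

    linear-add : ∀ x y → g (addP x y) ≡ g x + g y
    linear-add x y = trans (sym (proj₂ lin _)) (trans (dot-add r (proj₁ lin) x y) (cong₂ _+_ (proj₂ lin x) (proj₂ lin y)))

    linear-scale : ∀ t x → g (scaleP t x) ≡ t * g x
    linear-scale t x = trans (sym (proj₂ lin _)) (trans (dot-scale r (proj₁ lin) t x) (cong (t *_) (proj₂ lin x)))

    linear-extrapolate : ∀ t x y → g (addP (scaleP t x) (scaleP (- 1ℚ) y)) ≡ t * g x - g y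
    linear-extrapolate t x y = trans (linear-add _ _) (cong₂ _+_ (linear-scale t x)
      (trans (linear-scale (- 1ℚ) y) (solve 1 (λ u → con (- 1ℚ) :* u := :- u) refl (g y))))

  dot-linear : ∀ r c → IsLinear (dot r c)
  dot-linear r c = c , λ _ → refl

  sum-0* : ∀ n (x : Fin n → ℚ) → sumℚ n (λ i → 0ℚ * x i) ≡ 0ℚ
  sum-0* n x = sum-zero n (λ i → *-zeroˡ (x i))

  zero-linear : ∀ {r} → IsLinear {r} (λ _ → 0ℚ)
  zero-linear {r} = zeroP r , λ { (x , y) → trans (cong₂ _+_ (sum-0* r x) (sum-0* r y)) (+-identityˡ 0ℚ) }

  add-linear : ∀ {r} {f g : Point r → ℚ} → IsLinear f → IsLinear g → IsLinear (λ x → f x + g x)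
  add-linear {r} ((c , e) , p) ((c' , e') , q) = addP (c , e) (c' , e') , λ { (x , y) →
    trans (cong₂ _+_ (half c c' x) (half e e' y))
    (trans (+-interchange (sumℚ r (λ j → c j * x j)) (sumℚ r (λ j → c' j * x j)) (sumℚ r (λ j → e j * y j)) (sumℚ r (λ j → e' j * y j)))
           (cong₂ _+_ (p (x , y)) (q (x , y)))) }
    where
      half : ∀ (c d x : Fin r → ℚ) → sumℚ r (λ i → (c i + d i) * x i) ≡ sumℚ r (λ i → c i * x i) + sumℚ r (λ i → d i * x i)
      half c d x = trans (sum-cong r (λ i → *-distribʳ-+ (x i) (c i) (d i))) (sum-+ r _ _)

  scale-linear : ∀ {r} {f : Point r → ℚ} t → IsLinear f → IsLinear (λ x → t * f x)
  scale-linear {r} t ((c , e) , p) = scaleP t (c , e) , λ { (x , y) →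
    trans (cong₂ _+_ (half c x) (half e y)) (trans (sym (*-distribˡ-+ t _ _)) (cong (t *_) (p (x , y)))) }
    where
      half : ∀ (c x : Fin r → ℚ) → sumℚ r (λ i → t * c i * x i) ≡ t * sumℚ r (λ i → c i * x i)
      half c x = trans (sum-cong r (λ i → *-assoc t (c i) (x i))) (sum-*ˡ r t _)

  resp-linear : ∀ {r} {f g : Point r → ℚ} → IsLinear f → (∀ x → f x ≡ g x) → IsLinear g
  resp-linear (c , p) e = c , λ x → trans (p x) (e x)

  neg-linear : ∀ {r} {f : Point r → ℚ} → IsLinear f → IsLinear (λ x → - f x)
  neg-linear {f = f} l = resp-linear (scale-linear (- 1ℚ) l) (λ x → solve 1 (λ u → con (- 1ℚ) :* u := :- u) refl (f x))

  sub-linear : ∀ {r} {f g : Point r → ℚ} → IsLinear f → IsLinear g → IsLinear (λ x → f x - g x)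
  sub-linear l m = add-linear l (neg-linear m)

  tail-linear : ∀ {r} {f : Point r → ℚ} → IsLinear f → IsLinear (λ x → f (tailP x))
  tail-linear ((c , e) , p) = consP 0ℚ 0ℚ (c , e) , λ { (x , y) →
    trans (solve 4 (λ a b u v → con 0ℚ :* a :+ u :+ (con 0ℚ :* b :+ v) := u :+ v) refl (x zero) (y zero) _ _)
          (p (tailP (x , y))) }

  λ₀-linear : ∀ {r} → IsLinear {suc r} (λ x → proj₁ x zero)
  λ₀-linear {r} = consP 1ℚ 0ℚ (zeroP r) , λ { (x , y) →
    trans (cong₂ (λ u v → 1ℚ * x zero + u + (0ℚ * y zero + v)) (sum-0* r (λ i → x (suc i))) (sum-0* r (λ i → y (suc i))))
          (solve 2 (λ a b → con 1ℚ :* a :+ con 0ℚ :+ (con 0ℚ :* b :+ con 0ℚ) := a) refl (x zero) (y zero)) }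

  μ₀-linear : ∀ {r} → IsLinear {suc r} (λ x → proj₂ x zero)
  μ₀-linear {r} = consP 0ℚ 1ℚ (zeroP r) , λ { (x , y) →
    trans (cong₂ (λ u v → 0ℚ * x zero + u + (1ℚ * y zero + v)) (sum-0* r (λ i → x (suc i))) (sum-0* r (λ i → y (suc i))))
          (solve 2 (λ a b → con 0ℚ :* a :+ con 0ℚ :+ (con 1ℚ :* b :+ con 0ℚ) := b) refl (x zero) (y zero)) }

  -- Gaps, excess and slope along a point

  first : ∀ {n} → (Fin n → ℚ) → ℚ
  -- The default encodes λ_{r+1} = μ_{r+1} = 0, so that the last gap is the last part itself.
  first {zero}  f = 0ℚ
  first {suc n} f = f zero

  gap : ∀ {n} → (Fin (suc n) → ℚ) → ℚ
  gap f = f zero - first (λ i → f (suc i))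

  gapλ gapμ : ∀ {n} → Point (suc n) → ℚ
  gapλ p = gap (proj₁ p)
  gapμ p = gap (proj₂ p)

  -- On the part of a cone point after position k this is D_k, because the total sums agree.
  excess : ∀ {n} → Point n → ℚ
  excess {n} (x , y) = sumℚ n y - sumℚ n x

  slope : ∀ {n} → Point n → ℚ
  slope (x , y) = first x - first y

  excess-tail : ∀ {n} (p : Point (suc n)) → excess (tailP p) ≡ excess p + slope p
  excess-tail {n} (x , y) =
    solve 4 (λ a b s t → t :- s := (b :+ t) :- (a :+ s) :+ (a :- b)) refl (x zero) (y zero)
      (sumℚ n (λ i → x (suc i))) (sumℚ n (λ i → y (suc i)))

  slope-tail : ∀ {n} (p : Point (suc n)) → slope (tailP p) ≡ slope p - gapλ p + gapμ p
  slope-tail (x , y) =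
    solve 4 (λ a b s t → s :- t := a :- b :- (a :- s) :+ (b :- t)) refl (x zero) (y zero)
      (first (λ i → x (suc i))) (first (λ i → y (suc i)))

  Sign : Bool → ℚ → Set
  Sign true  q = 0ℚ < q
  Sign false q = q ≡ 0ℚ

  Vanish : Bool → ℚ → Set
  Vanish true  q = ⊤
  Vanish false q = q ≡ 0ℚ

  -- Inside the cone, `Exact w` describes the relative interior of the face of an accepted word `w`,
  -- and `Supp w` the whole face. Neither constrains `excess p`: for a tail `p` it is a D_k that the
  -- preceding letter has already recorded.
  Exact : ∀ {n} → Word n → Point n → Set
  Exact []                  p = ⊤
  Exact (⟨ d , a , b ⟩ ∷ w) p =
    Sign d (excess (tailP p)) × Sign a (gapλ p) × Sign b (gapμ p) × Exact w (tailP p)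

  Supp : ∀ {n} → Word n → Point n → Set
  Supp []                  p = ⊤
  Supp (⟨ d , a , b ⟩ ∷ w) p =
    Vanish d (excess (tailP p)) × Vanish a (gapλ p) × Vanish b (gapμ p) × Supp w (tailP p)

  -- `excess p` stays open so that the predicate applies to tails; `Cone` adds the equality of the
  -- two total sums.
  InCone : ∀ {n} → Point n → Set
  InCone {zero}  p = ⊤
  InCone {suc n} p = 0ℚ ≤ excess (tailP p) × 0ℚ ≤ gapλ p × 0ℚ ≤ gapμ p × InCone (tailP p)

  Cond : State → ℚ → ℚ → Set
  Cond free   D σ = D ≡ 0ℚ
  Cond flat   D σ = D ≡ 0ℚ × σ ≡ 0ℚ
  Cond rising D σ = 0ℚ ≤ D × 0ℚ < σ
  Cond raised D σ = 0ℚ < D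

  Sign⇒nonneg : ∀ d {q} → Sign d q → 0ℚ ≤ q
  Sign⇒nonneg true  h = <⇒≤ h
  Sign⇒nonneg false h = ≤-reflexive (sym h)

  pos-nonpos-⊥ : ∀ {p} → 0ℚ < p → 0ℚ ≤ - p → ⊥
  pos-nonpos-⊥ 0<p h = pos⇒≢0 0<p (nonneg-neg-zero (<⇒≤ 0<p) h)

  -- Supports of cone points are accepted

  StepTo : State → Letter → ℚ → ℚ → Set
  StepTo s ℓ D σ = Σ State λ s' → step s ℓ ≡ just s' × Cond s' D σ

  step-flat : ∀ d a b {D' σ' α β} → D' ≡ 0ℚ → σ' ≡ β - α →
    Sign d D' → Sign a α → Sign b β → 0ℚ ≤ σ' → StepTo flat ⟨ d , a , b ⟩ D' σ'
  step-flat true  a     b     D≡0 σ≡ sd sa sb h = ⊥-elim (pos⇒≢0 sd D≡0)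
  step-flat false false false D≡0 σ≡ sd refl refl h = flat , refl , D≡0 , σ≡
  step-flat false true  true  D≡0 σ≡ sd sa sb h = free , refl , D≡0
  step-flat false false true {β = β} D≡0 σ≡ sd refl sb h =
    rising , refl , ≤-reflexive (sym D≡0) , subst (0ℚ <_) (sym (trans σ≡ (solve 1 (λ b → b :- con 0ℚ := b) refl β))) sb
  step-flat false true  false {α = α} D≡0 σ≡ sd sa refl h =
    ⊥-elim (pos-nonpos-⊥ sa (subst (0ℚ ≤_) (trans σ≡ (+-identityˡ (- α))) h))

  step-rising : ∀ d a b {σ D' σ' α β} → 0ℚ < D' → 0ℚ < σ → σ' ≡ σ - α + β →
    Sign d D' → Sign a α → Sign b β → StepTo rising ⟨ d , a , b ⟩ D' σ'
  step-rising false a     b D>0 σ>0 σ≡ sd sa sb = ⊥-elim (pos⇒≢0 D>0 sd)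
  step-rising true  true  b D>0 σ>0 σ≡ sd sa sb = raised , refl , D>0
  step-rising true  false b {σ} {β = β} D>0 σ>0 σ≡ sd refl sb =
    rising , refl , <⇒≤ D>0 ,
    subst (0ℚ <_) (sym (trans σ≡ (solve 2 (λ s b → s :- con 0ℚ :+ b := s :+ b) refl σ β))) (+-pos-nonneg σ>0 (Sign⇒nonneg b sb))

  -- Besides the two recurrences only one fact about later positions enters: D cannot leave 0
  -- downwards. It excludes `lam` without `mu` on a flat stretch at 0. It also excludes a return to
  -- 0 without `mu`, since D + σ = 0 with D > 0 forces σ < 0.
  step-sound : ∀ s ℓ {D σ D' σ' α β} → D' ≡ D + σ → σ' ≡ σ - α + β →
    Sign (Letter.off ℓ) D' → Sign (Letter.lam ℓ) α → Sign (Letter.mu ℓ) β → (D' ≡ 0ℚ → 0ℚ ≤ σ') →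
    Cond s D σ → StepTo s ℓ D' σ'
  step-sound flat ⟨ d , a , b ⟩ {α = α} {β} D'≡ σ'≡ sd sa sb h (refl , refl) =
    step-flat d a b D'≡ (trans σ'≡ (solve 2 (λ a b → con 0ℚ :- a :+ b := b :- a) refl α β)) sd sa sb (h D'≡)
  step-sound rising ⟨ d , a , b ⟩ D'≡ σ'≡ sd sa sb h (D≥0 , σ>0) =
    step-rising d a b (subst (0ℚ <_) (sym D'≡) (+-nonneg-pos D≥0 σ>0)) σ>0 σ'≡ sd sa sb
  step-sound raised ⟨ true  , a , b ⟩ D'≡ σ'≡ sd sa sb h D>0 = raised , refl , sd
  step-sound raised ⟨ false , a , true ⟩ D'≡ σ'≡ sd sa sb h D>0 = free , refl , sd
  step-sound raised ⟨ false , a , false ⟩ {D} {σ} {α = α} D'≡ σ'≡ refl sa refl h D>0 =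
    ⊥-elim (pos-nonpos-⊥ (+-pos-nonneg D>0 (Sign⇒nonneg a sa)) (subst (0ℚ ≤_)
      (trans σ'≡ (trans (solve 3 (λ D s a → s :- a :+ con 0ℚ := (D :+ s) :- (D :+ a)) refl D σ α)
        (trans (cong (_- (D + α)) (sym D'≡)) (+-identityˡ (- (D + α)))))) (h refl)))
  step-sound free ⟨ false , a , b ⟩ {σ = σ} {α = α} {β} D'≡ σ'≡ sd sa sb h refl =
    step-flat false a b sd (trans σ'≡ (trans (cong (λ s → s - α + β) σ≡0) (solve 2 (λ a b → con 0ℚ :- a :+ b := b :- a) refl α β))) sd sa sb (h sd)
    where
      σ≡0 : σ ≡ 0ℚ
      σ≡0 = trans (sym (+-identityˡ σ)) (trans (sym D'≡) sd)
  step-sound free ⟨ true , a , b ⟩ {σ = σ} D'≡ σ'≡ sd sa sb h refl =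
    step-rising true a b sd (subst (0ℚ <_) (trans D'≡ (+-identityˡ σ)) sd) σ'≡ sd sa sb

  Exact⇒InCone : ∀ {n} (w : Word n) p → Exact w p → InCone p
  Exact⇒InCone []                  p _ = tt
  Exact⇒InCone (⟨ d , a , b ⟩ ∷ w) p (sd , sa , sb , e) =
    Sign⇒nonneg d sd , Sign⇒nonneg a sa , Sign⇒nonneg b sb , Exact⇒InCone w (tailP p) e

  slope-nonneg : ∀ {n} (p : Point n) → InCone p → excess p ≡ 0ℚ → 0ℚ ≤ slope p
  slope-nonneg {zero}  p _ _ = ≤-refl
  slope-nonneg {suc n} p (h , _) e =
    subst (0ℚ ≤_) (trans (excess-tail p) (trans (cong (_+ slope p) e) (+-identityˡ (slope p)))) h

  StepTo-Valid : ∀ {n} {w : Word n} {D σ} s ℓ → StepTo s ℓ D σ → (∀ s' → Cond s' D σ → Valid s' w) → Valid s (ℓ ∷ w)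
  StepTo-Valid {w = w} s ℓ (s' , eq , c) h = subst (λ m → ValidFrom m w) (sym eq) (h s' c)

  Exact⇒Valid : ∀ {n} s (w : Word n) p → Exact w p → Cond s (excess p) (slope p) → Valid s w
  Exact⇒Valid free   [] p _ _ = tt
  Exact⇒Valid flat   [] p _ _ = tt
  Exact⇒Valid rising [] p _ (_ , h) = <⇒≢ h refl
  Exact⇒Valid raised [] p _ h = <⇒≢ h refl
  Exact⇒Valid s (ℓ ∷ w) p (sd , sa , sb , e) c =
    StepTo-Valid s ℓ (step-sound s ℓ (excess-tail p) (slope-tail p) sd sa sb (slope-nonneg (tailP p) (Exact⇒InCone w _ e)) c)
      (λ s' → Exact⇒Valid s' w (tailP p) e)

  -- Every accepted word is realised

  record Realisation {n} (w : Word n) (D σ : ℚ) : Set where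
    constructor realisation
    field
      point  : Point n
      exact  : Exact w point
      excess≡ : excess point ≡ D
      slope≡  : slope point ≡ σ

  -- From raised the slope may be forced by the excess (a run of ⟨ _ , false , false ⟩ letters is a straight line down to 0), so only
  -- one ray of pairs (excess , slope) is claimed, whereas rising admits all pairs.
  Realisable : ∀ {n} → State → Word n → Set
  Realisable free   w = Σ ℚ λ σ → 0ℚ ≤ σ × Realisation w 0ℚ σ
  Realisable flat   w = Realisation w 0ℚ 0ℚ
  Realisable rising w = ∀ D σ → 0ℚ ≤ D → 0ℚ < σ → Realisation w D σ
  Realisable raised w = Σ ℚ λ p → Σ ℚ λ q → 0ℚ < p × 0ℚ < q × (∀ t → 0ℚ < t → Realisation w (p * t) (- (q * t)))

  -- These are `excess-tail` and `slope-tail` solved for the head: points are built from the last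
  -- position backwards, and the gaps `α` and `β` are tuned to the required slope.
  prepend : ∀ {n d a b} {w : Word n} {D' σ' D σ} α β → Sign d D' → Sign a α → Sign b β →
    D ≡ D' - σ → σ ≡ σ' + α - β → Realisation w D' σ' → Realisation (⟨ d , a , b ⟩ ∷ w) D σ
  prepend {n} {d} {a} {b} {D' = D'} {σ'} {D} {σ} α β sd sa sb D≡ σ≡ (realisation (x , y) ex refl refl) =
    realisation p (sd , subst (Sign a) (sym (gap-cons α (first x))) sa , subst (Sign b) (sym (gap-cons β (first y))) sb , ex) ep sp
    where
      p : Point (suc n)
      p = consP (α + first x) (β + first y) (x , y)
      gap-cons : ∀ α f → α + f - f ≡ α
      gap-cons = solve 2 (λ α f → α :+ f :- f := α) refl
      sp : slope p ≡ σ
      sp = trans (solve 4 (λ a b s t → a :+ s :- (b :+ t) := s :- t :+ a :- b) refl α β (first x) (first y)) (sym σ≡)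
      ep : excess p ≡ D
      ep = trans (solve 2 (λ e s → e := e :+ s :- s) refl (excess p) (slope p))
             (trans (cong₂ _-_ (sym (excess-tail p)) sp) (sym D≡))

  flat⇒free : ∀ {n} {w : Word n} → Realisable flat w → Realisable free w
  flat⇒free R = 0ℚ , ≤-refl , R

  rising⇒free : ∀ {n} {w : Word n} → Realisable rising w → Realisable free w
  rising⇒free R = 1ℚ , <⇒≤ 0<1 , R 0ℚ 1ℚ ≤-refl 0<1

  realise-flat : ∀ {n} (w : Word n) → Valid flat w → Realisable flat w
  realise-free : ∀ {n} (w : Word n) → Valid free w → Realisable free w
  realise-rising : ∀ {n} (w : Word n) → Valid rising w → Realisable rising w
  realise-raised : ∀ {n} (w : Word n) → Valid raised w → Realisable raised w

  realise-free w@[] v = flat⇒free {w = w} (realise-flat w v)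
  realise-free w@(⟨ false , a , b ⟩ ∷ _) v = flat⇒free {w = w} (realise-flat w v)
  realise-free w@(⟨ true , a , b ⟩ ∷ _) v = rising⇒free {w = w} (realise-rising w v)

  realise-flat [] v = realisation ((λ ()) , (λ ())) tt refl refl
  realise-flat (⟨ false , false , false ⟩ ∷ w) v =
    prepend 0ℚ 0ℚ refl refl refl refl refl (realise-flat w v)
  realise-flat (⟨ false , true , true ⟩ ∷ w) v with realise-free w v
  -- The two gaps differ by whatever slope the tail has, which makes the slope in front of them 0.
  ... | σ , 0≤σ , R = prepend 1ℚ (1ℚ + σ) refl 0<1 (+-pos-nonneg 0<1 0≤σ) refl
        (solve 1 (λ s → con 0ℚ := s :+ con 1ℚ :- (con 1ℚ :+ s)) refl σ) R
  realise-flat (⟨ false , false , true ⟩ ∷ w) v =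
    prepend 0ℚ 1ℚ refl refl 0<1 refl refl (realise-rising w v 0ℚ 1ℚ ≤-refl 0<1)
  realise-rising (⟨ true , false , false ⟩ ∷ w) v D σ 0≤D 0<σ =
    prepend 0ℚ 0ℚ D'>0 refl refl (solve 2 (λ D s → D := D :+ s :- s) refl D σ)
      (solve 1 (λ s → s := s :+ con 0ℚ :- con 0ℚ) refl σ) (realise-rising w v (D + σ) σ (<⇒≤ D'>0) 0<σ)
    where
      D'>0 = +-nonneg-pos 0≤D 0<σ
  realise-rising (⟨ true , false , true ⟩ ∷ w) v D σ 0≤D 0<σ =
    prepend 0ℚ 1ℚ D'>0 refl 0<1 (solve 2 (λ D s → D := D :+ s :- s) refl D σ)
      (solve 1 (λ s → s := s :+ con 1ℚ :+ con 0ℚ :- con 1ℚ) refl σ) (realise-rising w v (D + σ) (σ + 1ℚ) (<⇒≤ D'>0) (+-pos 0<σ 0<1))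
    where
      D'>0 = +-nonneg-pos 0≤D 0<σ
  realise-rising (⟨ true , true , b ⟩ ∷ w) v D σ 0≤D 0<σ with realise-raised w v
  ... | p , q , 0<p , 0<q , R with recip-pos p 0<p
  ...   | i , ip≡1 , 0<i = go b
    where
      D'>0 = +-nonneg-pos 0≤D 0<σ
      -- The ray of the tail is entered where its excess p t equals the prescribed D + σ; the bend
      -- then takes the slope from σ down to - q t.
      t = i * (D + σ)
      0<t = *-pos 0<i D'>0
      pt≡ : p * t ≡ D + σ
      pt≡ = trans (solve 3 (λ p i u → p :* (i :* u) := i :* p :* u) refl p i (D + σ)) (trans (cong (_* (D + σ)) ip≡1) (*-identityˡ (D + σ)))
      D≡ : D ≡ p * t - σ
      D≡ = trans (solve 2 (λ D s → D := D :+ s :- s) refl D σ) (cong (_- σ) (sym pt≡))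
      go : ∀ b → Realisation (⟨ true , true , b ⟩ ∷ w) D σ
      go false = prepend (σ + q * t) 0ℚ (*-pos 0<p 0<t) (+-pos 0<σ (*-pos 0<q 0<t)) refl D≡
        (solve 2 (λ s u → s := :- u :+ (s :+ u) :- con 0ℚ) refl σ (q * t)) (R t 0<t)
      go true = prepend (σ + q * t + 1ℚ) 1ℚ (*-pos 0<p 0<t) (+-pos (+-pos 0<σ (*-pos 0<q 0<t)) 0<1) 0<1 D≡
        (solve 2 (λ s u → s := :- u :+ (s :+ u :+ con 1ℚ) :- con 1ℚ) refl σ (q * t)) (R t 0<t)
  realise-raised (⟨ true , false , false ⟩ ∷ w) v with realise-raised w v
  ... | p , q , 0<p , 0<q , R = p + q , q , +-pos 0<p 0<q , 0<q , λ t 0<t →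
    prepend 0ℚ 0ℚ (*-pos 0<p 0<t) refl refl
      (solve 3 (λ p q t → (p :+ q) :* t := p :* t :- :- (q :* t)) refl p q t)
      (solve 2 (λ q t → :- (q :* t) := :- (q :* t) :+ con 0ℚ :- con 0ℚ) refl q t) (R t 0<t)
  realise-raised (⟨ true , true , false ⟩ ∷ w) v with realise-raised w v
  ... | p , q , 0<p , 0<q , R = p + p + q , q , +-pos (+-pos 0<p 0<p) 0<q , 0<q , λ t 0<t →
    -- The tail is taken at 2 t: its slope - 2 q t is steeper than - q t by the gap q t, which is
    -- positive as `lam` demands.
    prepend (q * t) 0ℚ (*-pos 0<p (+-pos 0<t 0<t)) (*-pos 0<q 0<t) refl
      (solve 3 (λ p q t → (p :+ p :+ q) :* t := p :* (t :+ t) :- :- (q :* t)) refl p q t)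
      (solve 2 (λ q t → :- (q :* t) := :- (q :* (t :+ t)) :+ q :* t :- con 0ℚ) refl q t) (R (t + t) (+-pos 0<t 0<t))
  realise-raised (⟨ true , false , true ⟩ ∷ w) v with realise-raised w v
  ... | p , q , 0<p , 0<q , R = p + q + 1ℚ , q + 1ℚ , +-pos (+-pos 0<p 0<q) 0<1 , +-pos 0<q 0<1 , λ t 0<t →
    prepend 0ℚ t (*-pos 0<p 0<t) refl 0<t
      (solve 3 (λ p q t → (p :+ q :+ con 1ℚ) :* t := p :* t :- :- ((q :+ con 1ℚ) :* t)) refl p q t)
      (solve 2 (λ q t → :- ((q :+ con 1ℚ) :* t) := :- (q :* t) :+ con 0ℚ :- t) refl q t) (R t 0<t)
  realise-raised (⟨ true , true , true ⟩ ∷ w) v with realise-raised w v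
  ... | p , q , 0<p , 0<q , R = p + q , q , +-pos 0<p 0<q , 0<q , λ t 0<t →
    prepend t t (*-pos 0<p 0<t) 0<t 0<t
      (solve 3 (λ p q t → (p :+ q) :* t := p :* t :- :- (q :* t)) refl p q t)
      (solve 2 (λ q t → :- (q :* t) := :- (q :* t) :+ t :- t) refl q t) (R t 0<t)
  realise-raised (⟨ false , a , true ⟩ ∷ w) v with realise-free w v
  -- The excess falls from t to 0 in a single step, hence the slope - t and p = q = 1; the gap of μ
  -- absorbs the turn from - t to the slope of the tail.
  ... | σ , 0≤σ , R = 1ℚ , 1ℚ , 0<1 , 0<1 , go a
    where
      go : ∀ a t → 0ℚ < t → Realisation (⟨ false , a , true ⟩ ∷ w) (1ℚ * t) (- (1ℚ * t))
      go false t 0<t = prepend 0ℚ (t + σ) refl refl (+-pos-nonneg 0<t 0≤σ)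
        (solve 1 (λ t → con 1ℚ :* t := con 0ℚ :- (:- (con 1ℚ :* t))) refl t)
        (solve 2 (λ t s → :- (con 1ℚ :* t) := s :+ con 0ℚ :- (t :+ s)) refl t σ) R
      go true t 0<t = prepend t (t + t + σ) refl 0<t (+-pos-nonneg (+-pos 0<t 0<t) 0≤σ)
        (solve 1 (λ t → con 1ℚ :* t := con 0ℚ :- (:- (con 1ℚ :* t))) refl t)
        (solve 2 (λ t s → :- (con 1ℚ :* t) := s :+ t :- (t :+ t :+ s)) refl t σ) R

  -- The cone given by inequalities

  firstλ-linear : ∀ {n} → IsLinear {n} (λ p → first (proj₁ p))
  firstλ-linear {zero}  = zero-linear
  firstλ-linear {suc n} = λ₀-linear

  firstμ-linear : ∀ {n} → IsLinear {n} (λ p → first (proj₂ p))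
  firstμ-linear {zero}  = zero-linear
  firstμ-linear {suc n} = μ₀-linear

  gapλ-linear : ∀ {n} → IsLinear {suc n} gapλ
  gapλ-linear = sub-linear λ₀-linear (tail-linear firstλ-linear)

  gapμ-linear : ∀ {n} → IsLinear {suc n} gapμ
  gapμ-linear = sub-linear μ₀-linear (tail-linear firstμ-linear)

  excess-linear : ∀ {n} → IsLinear {n} excess
  excess-linear {zero}  = resp-linear zero-linear (λ _ → refl)
  excess-linear {suc n} = resp-linear (add-linear (tail-linear excess-linear) (sub-linear μ₀-linear λ₀-linear)) λ { (x , y) →
    solve 4 (λ a b s t → t :- s :+ (b :- a) := (b :+ t) :- (a :+ s)) refl (x zero) (y zero)
      (sumℚ n (λ i → x (suc i))) (sumℚ n (λ i → y (suc i))) }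

  total : ∀ {n} → Point n → ℚ
  total {n} = dot n ((λ _ → 1ℚ) , (λ _ → 1ℚ))

  total-linear : ∀ {n} → IsLinear {n} total
  total-linear {n} = dot-linear n ((λ _ → 1ℚ) , (λ _ → 1ℚ))

  tail-≈P : ∀ {n} {p q : Point (suc n)} → p ≈P q → tailP p ≈P tailP q
  tail-≈P (e , f) = (λ i → e (suc i)) , (λ i → f (suc i))

  InCone-cong : ∀ {n} {p q : Point n} → p ≈P q → InCone p → InCone q
  InCone-cong {zero}  e _ = tt
  InCone-cong {suc n} {p} {q} e (hd , ha , hb , h) =
    subst (0ℚ ≤_) (linear-cong excess-linear (tail-≈P {p = p} {q} e)) hd ,
    subst (0ℚ ≤_) (linear-cong gapλ-linear {p} {q} e) ha ,
    subst (0ℚ ≤_) (linear-cong gapμ-linear {p} {q} e) hb ,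
    InCone-cong (tail-≈P {p = p} {q} e) h

  sum-nonneg-* : ∀ k {t f : Fin k → ℚ} → (∀ i → 0ℚ ≤ t i) → (∀ i → 0ℚ ≤ f i) → 0ℚ ≤ sumℚ k (λ i → t i * f i)
  sum-nonneg-* k ht hf = sum-nonneg k (λ i → *-nonneg (ht i) (hf i))

  InCone-lincomb : ∀ {n} k (t : Fin k → ℚ) (v : Fin k → Point n) →
    (∀ i → 0ℚ ≤ t i) → (∀ i → InCone (v i)) → InCone (lincomb n k t v)
  InCone-lincomb {zero}  k t v ht hv = tt
  InCone-lincomb {suc n} k t v ht hv =
    subst (0ℚ ≤_) (sym (linear-lincomb excess-linear k t (λ i → tailP (v i)))) (sum-nonneg-* k ht (λ i → proj₁ (hv i))) ,
    subst (0ℚ ≤_) (sym (linear-lincomb gapλ-linear k t v)) (sum-nonneg-* k ht (λ i → proj₁ (proj₂ (hv i)))) ,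
    subst (0ℚ ≤_) (sym (linear-lincomb gapμ-linear k t v)) (sum-nonneg-* k ht (λ i → proj₁ (proj₂ (proj₂ (hv i))))) ,
    InCone-lincomb k t (λ i → tailP (v i)) ht (λ i → proj₂ (proj₂ (proj₂ (hv i))))

  InCone-scale : ∀ {n} t (p : Point n) → 0ℚ ≤ t → InCone p → InCone (scaleP t p)
  InCone-scale t p 0≤t h = InCone-cong ((λ i → +-identityʳ _) , (λ i → +-identityʳ _))
    (InCone-lincomb 1 (λ _ → t) (λ _ → p) (λ _ → 0≤t) (λ _ → h))

  InCone-add : ∀ {n} (p q : Point n) → InCone p → InCone q → InCone (addP p q)
  InCone-add {n} p q hp hq = InCone-cong ((λ i → eq (proj₁ p i) (proj₁ q i)) , (λ i → eq (proj₂ p i) (proj₂ q i)))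
    (InCone-lincomb 2 (λ _ → 1ℚ) pq (λ _ → <⇒≤ 0<1) (λ { zero → hp ; (suc zero) → hq }))
    where
      pq : Fin 2 → Point n
      pq zero    = p
      pq (suc _) = q
      eq : ∀ a b → 1ℚ * a + (1ℚ * b + 0ℚ) ≡ a + b
      eq = solve 2 (λ a b → con 1ℚ :* a :+ (con 1ℚ :* b :+ con 0ℚ) := a :+ b) refl

  Cone : ∀ {n} → Point n → Set
  Cone p = excess p ≡ 0ℚ × InCone p

  Descending : ∀ {n} → (Fin n → ℚ) → Set
  Descending {zero}  f = ⊤
  Descending {suc n} f = 0ℚ ≤ gap f × Descending (λ i → f (suc i))

  descendingλ : ∀ {n} (p : Point n) → InCone p → Descending (proj₁ p)
  descendingλ {zero}  p h = tt
  descendingλ {suc n} p (_ , ha , _ , h) = ha , descendingλ (tailP p) h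

  descendingμ : ∀ {n} (p : Point n) → InCone p → Descending (proj₂ p)
  descendingμ {zero}  p h = tt
  descendingμ {suc n} p (_ , _ , hb , h) = hb , descendingμ (tailP p) h

  first-nonneg : ∀ {n} (f : Fin n → ℚ) → Descending f → 0ℚ ≤ first f
  first-nonneg {zero}  f h = ≤-refl
  first-nonneg {suc n} f (hg , h) = ≤-trans (first-nonneg (λ i → f (suc i)) h) (0≤-⇒≤ hg)

  descending-nonneg : ∀ {n} (f : Fin n → ℚ) → Descending f → ∀ i → 0ℚ ≤ f i
  descending-nonneg f h       zero    = first-nonneg f h
  descending-nonneg f (_ , h) (suc i) = descending-nonneg (λ i → f (suc i)) h i

  descending-≤first : ∀ {n} (f : Fin n → ℚ) → Descending f → ∀ i → f i ≤ first f
  descending-≤first f h        zero    = ≤-refl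
  descending-≤first f (hg , h) (suc i) = ≤-trans (descending-≤first (λ i → f (suc i)) h i) (0≤-⇒≤ hg)

  descending-mono : ∀ {n} (f : Fin n → ℚ) → Descending f → ∀ i j → i Fin.≤ j → f j ≤ f i
  descending-mono f h       zero    j       _         = descending-≤first f h j
  descending-mono f (_ , h) (suc i) (suc j) (s≤s i≤j) = descending-mono (λ i → f (suc i)) h i j i≤j

  -- The Kostka cone is the cone given by inequalities

  toℚᵘ-toℚ : ∀ n → toℚᵘ (toℚ n) ℚᵘ.≃ mkℚᵘ (ℤ.+ n) 0
  toℚᵘ-toℚ n = toℚᵘ-fromℚᵘ (mkℚᵘ (ℤ.+ n) 0)

  toℚ-+ : ∀ m n → toℚ (m ℕ.+ n) ≡ toℚ m + toℚ n
  toℚ-+ m n = toℚᵘ-injective (ℚᵘP.≃-trans (toℚᵘ-toℚ (m ℕ.+ n)) (ℚᵘP.≃-trans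
    (*≡* {mkℚᵘ (ℤ.+ (m ℕ.+ n)) 0} {mkℚᵘ (ℤ.+ m) 0 ℚᵘ.+ mkℚᵘ (ℤ.+ n) 0} (trans (ℤP.*-identityʳ (ℤ.+ (m ℕ.+ n)))
      (sym (trans (ℤP.*-identityʳ (ℤ.+ m ℤ.* ℤ.+ 1 ℤ.+ ℤ.+ n ℤ.* ℤ.+ 1)) (cong₂ ℤ._+_ (ℤP.*-identityʳ (ℤ.+ m)) (ℤP.*-identityʳ (ℤ.+ n)))))))
    (ℚᵘP.≃-sym (ℚᵘP.≃-trans (toℚᵘ-homo-+ (toℚ m) (toℚ n)) (ℚᵘP.+-cong (toℚᵘ-toℚ m) (toℚᵘ-toℚ n))))))

  toℚ-nonneg : ∀ n → 0ℚ ≤ toℚ n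
  toℚ-nonneg n = nonNegative⁻¹ (toℚ n) {{normalize-nonNeg n 1}}

  toℚ-pos : ∀ n → 0ℚ < toℚ (suc n)
  toℚ-pos n = positive⁻¹ (toℚ (suc n)) {{normalize-pos (suc n) 1}}

  toℚ-mono : ∀ {m n} → m ℕ.≤ n → toℚ m ≤ toℚ n
  toℚ-mono {m} {n} m≤n = subst₂ _≤_ (+-identityʳ (toℚ m)) (trans (sym (toℚ-+ m (n ℕ.∸ m))) (cong toℚ (ℕP.m+[n∸m]≡n m≤n)))
    (+-monoʳ-≤ (toℚ m) (toℚ-nonneg (n ℕ.∸ m)))

  toℚ-mono-< : ∀ {m n} → m ℕ.< n → toℚ m < toℚ n
  toℚ-mono-< {m} {n} m<n = subst₂ _<_ (+-identityʳ (toℚ m))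
    (trans (sym (toℚ-+ m (suc (n ℕ.∸ suc m)))) (cong toℚ (trans (ℕP.+-suc m _) (ℕP.m+[n∸m]≡n m<n))))
    (+-monoʳ-< (toℚ m) (toℚ-pos (n ℕ.∸ suc m)))

  toℚ-reflects-≤ : ∀ {m n} → toℚ m ≤ toℚ n → m ℕ.≤ n
  toℚ-reflects-≤ {m} {n} h with m ℕ.≤? n
  ... | yes m≤n = m≤n
  ... | no  m≰n = ⊥-elim (<⇒≢ (<-≤-trans (toℚ-mono-< (ℕP.≰⇒> m≰n)) h) refl)

  toℚ-* : ∀ m n → toℚ (m ℕ.* n) ≡ toℚ m * toℚ n
  toℚ-* zero    n = sym (*-zeroˡ (toℚ n))
  toℚ-* (suc m) n = trans (toℚ-+ n (m ℕ.* n)) (trans (cong (toℚ n +_) (toℚ-* m n))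
    (trans (solve 2 (λ a b → b :+ a :* b := (con 1ℚ :+ a) :* b) refl (toℚ m) (toℚ n)) (cong (_* toℚ n) (sym (toℚ-+ 1 m)))))

  sum-toℚ : ∀ n (l : Fin n → ℕ) → sumℚ n (λ i → toℚ (l i)) ≡ toℚ (sumℕ n l)
  sum-toℚ zero    l = refl
  sum-toℚ (suc n) l = trans (cong (toℚ (l zero) +_) (sum-toℚ n (λ i → l (suc i)))) (sym (toℚ-+ (l zero) (sumℕ n (λ i → l (suc i)))))

  partialSum-0 : ∀ n (l : Fin n → ℕ) → partialSum n 0 l ≡ 0
  partialSum-0 zero    l = refl
  partialSum-0 (suc n) l = partialSum-0 n (λ i → l (suc i))

  natPoint : ∀ {n} → (Fin n → ℕ) → (Fin n → ℕ) → Point n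
  natPoint l m = (λ i → toℚ (l i)) , (λ i → toℚ (m i))

  gap-partition : ∀ {n} (l : Fin (suc n) → ℕ) → IsPartition (suc n) l → 0ℚ ≤ gap (λ i → toℚ (l i))
  gap-partition {zero}  l h = ≤⇒0≤- (toℚ-nonneg (l zero))
  gap-partition {suc n} l h = ≤⇒0≤- (toℚ-mono (h zero (suc zero) z≤n))

  excess-natPoint : ∀ n (l m : Fin n → ℕ) → excess (natPoint l m) ≡ toℚ (sumℕ n m) - toℚ (sumℕ n l)
  excess-natPoint n l m = cong₂ _-_ (sum-toℚ n m) (sum-toℚ n l)

  partition-tail : ∀ {n} {l : Fin (suc n) → ℕ} → IsPartition (suc n) l → IsPartition n (λ i → l (suc i))
  partition-tail h i j i≤j = h (suc i) (suc j) (s≤s i≤j)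

  -- A and B are the sums of the parts already removed from l and m.
  natPoint-InCone : ∀ n (l m : Fin n → ℕ) A B → IsPartition n l → IsPartition n m →
    (∀ k → k ℕ.≤ n → B ℕ.+ partialSum n k m ℕ.≤ A ℕ.+ partialSum n k l) →
    B ℕ.+ sumℕ n m ≡ A ℕ.+ sumℕ n l → InCone (natPoint l m)
  natPoint-InCone zero    l m A B hl hm dom eq = tt
  natPoint-InCone (suc n) l m A B hl hm dom eq =
    subst (0ℚ ≤_) (sym (excess-natPoint n l' m')) (≤⇒0≤- (toℚ-mono Σl'≤Σm')) ,
    gap-partition l hl , gap-partition m hm ,
    natPoint-InCone n l' m' (A ℕ.+ l zero) (B ℕ.+ m zero) (partition-tail hl) (partition-tail hm)
      (λ k k≤n → subst₂ ℕ._≤_ (sym (ℕP.+-assoc B (m zero) _)) (sym (ℕP.+-assoc A (l zero) _)) (dom (suc k) (s≤s k≤n)))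
      eq'
    where
      l' m' : Fin n → ℕ
      l' i = l (suc i)
      m' i = m (suc i)
      eq' : B ℕ.+ m zero ℕ.+ sumℕ n m' ≡ A ℕ.+ l zero ℕ.+ sumℕ n l'
      eq' = trans (ℕP.+-assoc B (m zero) _) (trans eq (sym (ℕP.+-assoc A (l zero) _)))
      head : ∀ C (f : Fin (suc n) → ℕ) → C ℕ.+ partialSum (suc n) 1 f ≡ C ℕ.+ f zero
      head C f = trans (cong (λ z → C ℕ.+ (f zero ℕ.+ z)) (partialSum-0 n (λ i → f (suc i)))) (cong (C ℕ.+_) (ℕP.+-identityʳ (f zero)))
      B≤A : B ℕ.+ m zero ℕ.≤ A ℕ.+ l zero
      B≤A = subst₂ ℕ._≤_ (head B m) (head A l) (dom 1 (s≤s z≤n))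
      Σl'≤Σm' : sumℕ n l' ℕ.≤ sumℕ n m'
      Σl'≤Σm' = ℕP.+-cancelˡ-≤ (A ℕ.+ l zero) _ _ (ℕP.≤-trans (ℕP.≤-reflexive (sym eq')) (ℕP.+-monoˡ-≤ (sumℕ n m') B≤A))

  generator⇒Cone : ∀ {r} {p : Point r} → KostkaGenerator r p → Cone p
  generator⇒Cone {r} {p} (l , m , hl , hm , eq , dom , p≈) =
    trans (linear-cong excess-linear {p} {natPoint l m} p≈)
      (trans (excess-natPoint r l m) (trans (cong (λ z → toℚ (sumℕ r m) - toℚ z) eq) (+-inverseʳ (toℚ (sumℕ r m))))) ,
    InCone-cong {p = natPoint l m} {p} ((λ i → sym (proj₁ p≈ i)) , (λ i → sym (proj₂ p≈ i)))
      (natPoint-InCone r l m 0 0 hl hm dom (sym eq))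

  KostkaCone⇒Cone : ∀ {r} {p : Point r} → KostkaCone r p → Cone p
  KostkaCone⇒Cone {r} {p} (k , t , v , ht , _ , gen , p≈) =
    trans (linear-cong excess-linear {p} {lincomb r k t v} p≈)
      (trans (linear-lincomb excess-linear k t v)
        (sum-zero k (λ i → trans (cong (t i *_) (proj₁ (generator⇒Cone {p = v i} (gen i)))) (*-zeroʳ (t i))))) ,
    InCone-cong {p = lincomb r k t v} {p} ((λ i → sym (proj₁ p≈ i)) , (λ i → sym (proj₂ p≈ i)))
      (InCone-lincomb k t v ht (λ i → proj₂ (generator⇒Cone {p = v i} (gen i))))

  excess-nat⇒≤ : ∀ n (l m : Fin n → ℕ) → 0ℚ ≤ excess (natPoint l m) → sumℕ n l ℕ.≤ sumℕ n m
  excess-nat⇒≤ n l m h = toℚ-reflects-≤ (0≤-⇒≤ (subst (0ℚ ≤_) (excess-natPoint n l m) h))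

  -- After cancelling the first k parts the claim says that the k-th tail has nonnegative excess.
  -- Adding the totals crosswise keeps it free of subtraction and valid for tails, whose totals
  -- differ.
  InCone⇒dominance : ∀ n (l m : Fin n → ℕ) → InCone (natPoint l m) → sumℕ n l ℕ.≤ sumℕ n m →
    ∀ k → sumℕ n l ℕ.+ partialSum n k m ℕ.≤ sumℕ n m ℕ.+ partialSum n k l
  InCone⇒dominance n l m h le zero =
    subst₂ ℕ._≤_ (cong (sumℕ n l ℕ.+_) (sym (partialSum-0 n m))) (cong (sumℕ n m ℕ.+_) (sym (partialSum-0 n l))) (ℕP.+-monoˡ-≤ 0 le)
  InCone⇒dominance zero l m h le (suc k) = z≤n
  InCone⇒dominance (suc n) l m (hd , _ , _ , h) le (suc k) =
    subst₂ ℕ._≤_ (lem (l zero) (m zero) _ _) (trans (cong (ℕ._+ (sumℕ n m' ℕ.+ partialSum n k l')) (ℕP.+-comm (l zero) (m zero))) (lem (m zero) (l zero) _ _))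
      (ℕP.+-monoʳ-≤ (l zero ℕ.+ m zero) (InCone⇒dominance n l' m' h (excess-nat⇒≤ n l' m' hd) k))
    where
      l' m' : Fin n → ℕ
      l' i = l (suc i)
      m' i = m (suc i)
      lem : ∀ a b c d → a ℕ.+ b ℕ.+ (c ℕ.+ d) ≡ a ℕ.+ c ℕ.+ (b ℕ.+ d)
      lem = solve-∀

  natPoint-generator : ∀ r (l m : Fin r → ℕ) (p : Point r) → Cone (natPoint l m) → p ≈P natPoint l m → KostkaGenerator r p
  natPoint-generator r l m p (e , h) p≈ =
    l , m , (λ i j i≤j → toℚ-reflects-≤ (descending-mono _ (descendingλ (natPoint l m) h) i j i≤j)) ,
    (λ i j i≤j → toℚ-reflects-≤ (descending-mono _ (descendingμ (natPoint l m) h) i j i≤j)) ,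
    l≡m ,
    (λ k _ → ℕP.+-cancelˡ-≤ (sumℕ r m) _ _ (subst (λ z → z ℕ.+ partialSum r k m ℕ.≤ sumℕ r m ℕ.+ partialSum r k l) l≡m
               (InCone⇒dominance r l m h (ℕP.≤-reflexive l≡m) k))) ,
    p≈
    where
      e' : toℚ (sumℕ r m) - toℚ (sumℕ r l) ≡ 0ℚ
      e' = trans (sym (excess-natPoint r l m)) e
      l≡m : sumℕ r l ≡ sumℕ r m
      l≡m = ℕP.≤-antisym (excess-nat⇒≤ r l m (≤-reflexive (sym e)))
        (toℚ-reflects-≤ (0≤-⇒≤ (≤-reflexive (trans (sym (cong -_ e'))
          (solve 2 (λ a b → :- (a :- b) := b :- a) refl (toℚ (sumℕ r m)) (toℚ (sumℕ r l)))))))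

  denominator-clear : ∀ q → 0ℚ ≤ q → Σ ℕ λ d → Σ ℕ λ n → toℚ (suc d) * q ≡ toℚ n
  denominator-clear q@(mkℚ (ℤ.+ n) d _) _ = d , n , toℚᵘ-injective
    (ℚᵘP.≃-trans (toℚᵘ-homo-* (toℚ (suc d)) q)
    (ℚᵘP.≃-trans (ℚᵘP.*-cong (toℚᵘ-toℚ (suc d)) (ℚᵘP.≃-refl {mkℚᵘ (ℤ.+ n) d}))
    (ℚᵘP.≃-trans (*≡* (trans (cong (ℤ._* ℤ.+ 1) (sym (ℤP.pos-* (suc d) n)))
        (trans (sym (ℤP.pos-* (suc d ℕ.* n) 1)) (trans (cong ℤ.+_ (lem d n)) (ℤP.pos-* n (1 ℕ.* suc d))))))
                 (ℚᵘP.≃-sym (toℚᵘ-toℚ n)))))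
    where
      lem : ∀ d n → suc d ℕ.* n ℕ.* 1 ≡ n ℕ.* (1 ℕ.* suc d)
      lem = solve-∀
  denominator-clear (mkℚ ℤ.-[1+ n ] d _) (ℚ.*≤* ())

  denominators-clear : ∀ n (f : Fin n → ℚ) → (∀ i → 0ℚ ≤ f i) →
    Σ ℕ λ N → Σ (Fin n → ℕ) λ l → ∀ i → toℚ (suc N) * f i ≡ toℚ (l i)
  denominators-clear zero    f h = 0 , (λ ()) , λ ()
  denominators-clear (suc n) f h with denominator-clear (f zero) (h zero) | denominators-clear n (λ i → f (suc i)) (λ i → h (suc i))
  -- The successor of this number is `suc d * suc N`, the product of the two denominators.
  ... | d , m , e | N , l , es = N ℕ.+ d ℕ.* suc N , l' , es'
    where
      l' : Fin (suc n) → ℕ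
      l' zero    = suc N ℕ.* m
      l' (suc i) = suc d ℕ.* l i
      factor : ∀ q → toℚ (suc d ℕ.* suc N) * q ≡ toℚ (suc d) * (toℚ (suc N) * q)
      factor q = trans (cong (_* q) (toℚ-* (suc d) (suc N))) (*-assoc (toℚ (suc d)) (toℚ (suc N)) q)
      es' : ∀ i → toℚ (suc d ℕ.* suc N) * f i ≡ toℚ (l' i)
      es' zero = trans (factor (f zero))
        (trans (solve 3 (λ a b c → a :* (b :* c) := b :* (a :* c)) refl (toℚ (suc d)) (toℚ (suc N)) (f zero))
        (trans (cong (toℚ (suc N) *_) e) (sym (toℚ-* (suc N) m))))
      es' (suc i) = trans (factor (f (suc i))) (trans (cong (toℚ (suc d) *_) (es i)) (sym (toℚ-* (suc d) (l i))))

  Cone-scale : ∀ {n} t (p : Point n) → 0ℚ ≤ t → Cone p → Cone (scaleP t p)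
  Cone-scale t p 0≤t (e , h) = trans (linear-scale excess-linear t p) (trans (cong (t *_) e) (*-zeroʳ t)) , InCone-scale t p 0≤t h

  Cone-cong : ∀ {n} {p q : Point n} → p ≈P q → Cone p → Cone q
  Cone-cong {p = p} {q} p≈ (e , h) = trans (sym (linear-cong excess-linear {p} {q} p≈)) e , InCone-cong {p = p} {q} p≈ h

  Cone-add : ∀ {n} (p q : Point n) → Cone p → Cone q → Cone (addP p q)
  Cone-add p q (e , h) (f , k) = trans (linear-add excess-linear p q) (trans (cong₂ _+_ e f) (+-identityˡ 0ℚ)) , InCone-add p q h k

  -- The Kostka cone is a convex hull, so scaling alone is not allowed. Instead p is the convex
  -- combination of the integral point (N + 1) p and the zero pair, with weights 1 / (N + 1) and 1 -
  -- 1 / (N + 1).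
  natPoint-scale-Cone : ∀ {r} (p : Point r) N → Cone p → (l m : Fin r → ℕ) →
    scaleP (toℚ (suc N)) p ≈P natPoint l m → KostkaCone r p
  natPoint-scale-Cone {r} p N h l m eq =
    2 , weights , gens , (λ { zero → <⇒≤ 0<i ; (suc zero) → ≤⇒0≤- i≤1 }) ,
    solve 1 (λ i → i :+ (con 1ℚ :- i :+ con 0ℚ) := con 1ℚ) refl i ,
    (λ { zero → natPoint-generator r l m (natPoint l m)
           (Cone-cong {p = scaleP (toℚ (suc N)) p} {natPoint l m} eq (Cone-scale (toℚ (suc N)) p (toℚ-nonneg (suc N)) h))
           ((λ _ → refl) , (λ _ → refl))
       ; (suc zero) → natPoint-generator r (λ _ → 0) (λ _ → 0) (zeroP r) zero-Cone ((λ _ → refl) , (λ _ → refl)) }) ,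
    (λ j → coord (proj₁ p j) (proj₁ eq j)) , (λ j → coord (proj₂ p j) (proj₂ eq j))
    where
      i = proj₁ (recip-pos (toℚ (suc N)) (toℚ-pos N))
      iN≡1 : i * toℚ (suc N) ≡ 1ℚ
      iN≡1 = proj₁ (proj₂ (recip-pos (toℚ (suc N)) (toℚ-pos N)))
      0<i : 0ℚ < i
      0<i = proj₂ (proj₂ (recip-pos (toℚ (suc N)) (toℚ-pos N)))
      i≤1 : i ≤ 1ℚ
      i≤1 = subst₂ _≤_ (*-identityʳ i) iN≡1 (*-monoˡ-≤-nonNeg i {{nonNegative (<⇒≤ 0<i)}} (toℚ-mono {1} {suc N} (s≤s z≤n)))
      weights : Fin 2 → ℚ
      weights zero    = i
      weights (suc _) = 1ℚ - i
      gens : Fin 2 → Point r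
      gens zero    = natPoint l m
      gens (suc _) = zeroP r
      zero-Cone : Cone (natPoint {r} (λ _ → 0) (λ _ → 0))
      zero-Cone = Cone-cong {p = scaleP 0ℚ p} {natPoint (λ _ → 0) (λ _ → 0)}
        ((λ j → *-zeroˡ (proj₁ p j)) , (λ j → *-zeroˡ (proj₂ p j))) (Cone-scale 0ℚ p ≤-refl h)
      coord : ∀ q {u} → toℚ (suc N) * q ≡ u → q ≡ i * u + ((1ℚ - i) * 0ℚ + 0ℚ)
      coord q {u} e = trans (sym (*-identityˡ q)) (trans (cong (_* q) (sym iN≡1)) (trans (*-assoc i (toℚ (suc N)) q) (trans (cong (i *_) e)
        (solve 2 (λ i u → i :* u := i :* u :+ ((con 1ℚ :- i) :* con 0ℚ :+ con 0ℚ)) refl i u))))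

  Cone⇒KostkaCone : ∀ {r} {p : Point r} → Cone p → KostkaCone r p
  Cone⇒KostkaCone {r} {p} c@(_ , h)
    with denominators-clear r (proj₁ p) (descending-nonneg _ (descendingλ p h)) | denominators-clear r (proj₂ p) (descending-nonneg _ (descendingμ p h))
  ... | M , l , el | N , m , em =
    natPoint-scale-Cone p (N ℕ.+ M ℕ.* suc N) c (λ i → suc N ℕ.* l i) (λ i → suc M ℕ.* m i)
      ((λ i → trans (factor (proj₁ p i)) (trans (solve 3 (λ a b c → a :* (b :* c) := b :* (a :* c)) refl (toℚ (suc M)) (toℚ (suc N)) (proj₁ p i))
                (trans (cong (toℚ (suc N) *_) (el i)) (sym (toℚ-* (suc N) (l i)))))) ,
       (λ i → trans (factor (proj₂ p i)) (trans (cong (toℚ (suc M) *_) (em i)) (sym (toℚ-* (suc M) (m i))))))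
    where
      factor : ∀ q → toℚ (suc M ℕ.* suc N) * q ≡ toℚ (suc M) * (toℚ (suc N) * q)
      factor q = trans (cong (_* q) (toℚ-* (suc M) (suc N))) (*-assoc (toℚ (suc M)) (toℚ (suc N)) q)

  -- Support words of points

  sign-of : ∀ q → 0ℚ ≤ q → Σ Bool λ b → Sign b q
  sign-of q 0≤q with <-cmp 0ℚ q
  ... | tri< 0<q _ _ = true , 0<q
  ... | tri≈ _ 0≡q _ = false , sym 0≡q
  ... | tri> _ _ q<0 = ⊥-elim (<⇒≢ (<-≤-trans q<0 0≤q) refl)

  support : ∀ {n} (p : Point n) → InCone p → Σ (Word n) λ w → Exact w p
  support {zero}  p h = [] , tt
  support {suc n} p (hd , ha , hb , h) =
    let d , sd = sign-of (excess (tailP p)) hd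
        a , sa = sign-of (gapλ p) ha
        b , sb = sign-of (gapμ p) hb
        w , e  = support (tailP p) h
    in ⟨ d , a , b ⟩ ∷ w , sd , sa , sb , e

  Sign-Vanish : ∀ b c {q} → Sign b q → Vanish c q → Implies b c
  Sign-Vanish false c     s v = tt
  Sign-Vanish true  true  s v = tt
  Sign-Vanish true  false s v = pos⇒≢0 s v

  Exact-Supp⇒⊑ : ∀ {n} (w v : Word n) p → Exact w p → Supp v p → w ⊑ v
  Exact-Supp⇒⊑ [] [] p _ _ = tt
  Exact-Supp⇒⊑ (⟨ d , a , b ⟩ ∷ w) (⟨ d' , a' , b' ⟩ ∷ v) p (sd , sa , sb , e) (vd , va , vb , s) =
    Sign-Vanish d d' sd vd , Sign-Vanish a a' sa va , Sign-Vanish b b' sb vb , Exact-Supp⇒⊑ w v (tailP p) e s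

  Sign-Implies : ∀ b c {q} → Sign b q → Implies b c → Vanish c q
  Sign-Implies b     true  s i = tt
  Sign-Implies false false s i = s

  Exact-⊑⇒Supp : ∀ {n} (w v : Word n) p → Exact w p → w ⊑ v → Supp v p
  Exact-⊑⇒Supp [] [] p _ _ = tt
  Exact-⊑⇒Supp (⟨ d , a , b ⟩ ∷ w) (⟨ d' , a' , b' ⟩ ∷ v) p (sd , sa , sb , e) (id , ia , ib , l) =
    Sign-Implies d d' sd id , Sign-Implies a a' sa ia , Sign-Implies b b' sb ib , Exact-⊑⇒Supp w v (tailP p) e l

  Exact⇒Supp : ∀ {n} (w : Word n) p → Exact w p → Supp w p
  Exact⇒Supp w p e = Exact-⊑⇒Supp w w p e (⊑-refl w)

  Supp-mono : ∀ {n} (w v : Word n) p → InCone p → w ⊑ v → Supp w p → Supp v p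
  Supp-mono w v p h l s =
    let u , e = support p h in Exact-⊑⇒Supp u v p e (⊑-trans u w v (Exact-Supp⇒⊑ u w p e s) l)

  Sign-* : ∀ b {t q} → 0ℚ < t → Sign b q → Sign b (t * q)
  Sign-* true  0<t s    = *-pos 0<t s
  Sign-* false {t} 0<t refl = *-zeroʳ t

  Exact-scale : ∀ {n} (w : Word n) p {t} → 0ℚ < t → Exact w p → Exact w (scaleP t p)
  Exact-scale [] p 0<t _ = tt
  Exact-scale (⟨ d , a , b ⟩ ∷ w) p {t} 0<t (sd , sa , sb , e) =
    subst (Sign d) (sym (linear-scale excess-linear t (tailP p))) (Sign-* d 0<t sd) ,
    subst (Sign a) (sym (linear-scale gapλ-linear t p)) (Sign-* a 0<t sa) ,
    subst (Sign b) (sym (linear-scale gapμ-linear t p)) (Sign-* b 0<t sb) ,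
    Exact-scale w (tailP p) 0<t e

  Exact-cong : ∀ {n} (w : Word n) {p q : Point n} → p ≈P q → Exact w p → Exact w q
  Exact-cong [] _ _ = tt
  Exact-cong (⟨ d , a , b ⟩ ∷ w) {p} {q} pq (sd , sa , sb , e) =
    subst (Sign d) (linear-cong excess-linear (tail-≈P {p = p} {q} pq)) sd ,
    subst (Sign a) (linear-cong gapλ-linear {p} {q} pq) sa ,
    subst (Sign b) (linear-cong gapμ-linear {p} {q} pq) sb ,
    Exact-cong w (tail-≈P {p = p} {q} pq) e

  Sign-+ : ∀ b c {p q} → Sign b p → 0ℚ ≤ q → Sign c (p + q) → Implies b c
  Sign-+ false c     s h s' = tt
  Sign-+ true  true  s h s' = tt
  Sign-+ true  false s h s' = pos⇒≢0 (+-pos-nonneg s h) s'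

  -- Nonnegative values cannot cancel, so a sum keeps the support of each summand.
  Exact-add : ∀ {n} (w v : Word n) p q → Exact w p → InCone q → Exact v (addP p q) → w ⊑ v
  Exact-add [] [] p q _ _ _ = tt
  Exact-add (⟨ d , a , b ⟩ ∷ w) (⟨ d' , a' , b' ⟩ ∷ v) p q (sd , sa , sb , e) (hd , ha , hb , h) (sd' , sa' , sb' , e') =
    Sign-+ d d' sd hd (subst (Sign d') (linear-add excess-linear (tailP p) (tailP q)) sd') ,
    Sign-+ a a' sa ha (subst (Sign a') (linear-add gapλ-linear p q) sa') ,
    Sign-+ b b' sb hb (subst (Sign b') (linear-add gapμ-linear p q) sb') ,
    Exact-add w v (tailP p) (tailP q) e h e'

  -- Word faces and their normals

  pick : Bool → ℚ → ℚ
  pick true  q = 0ℚ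
  pick false q = q

  -- A supporting functional of the face of `w`: its summands are nonnegative on the cone, so it
  -- vanishes only where all of them do. Its negative serves as outer normal, with right-hand side
  -- 0.
  lack : ∀ {n} → Word n → Point n → ℚ
  lack []                  p = 0ℚ
  lack (⟨ d , a , b ⟩ ∷ w) p = pick d (excess (tailP p)) + (pick a (gapλ p) + (pick b (gapμ p) + lack w (tailP p)))

  pick-linear : ∀ {n} b {g : Point n → ℚ} → IsLinear g → IsLinear (λ p → pick b (g p))
  pick-linear true  l = zero-linear
  pick-linear false l = l

  lack-linear : ∀ {n} (w : Word n) → IsLinear (lack w)
  lack-linear []                  = zero-linear
  lack-linear (⟨ d , a , b ⟩ ∷ w) =
    add-linear (pick-linear d (tail-linear excess-linear))
      (add-linear (pick-linear a gapλ-linear) (add-linear (pick-linear b gapμ-linear) (tail-linear (lack-linear w))))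

  pick-nonneg : ∀ b {q} → 0ℚ ≤ q → 0ℚ ≤ pick b q
  pick-nonneg true  h = ≤-refl
  pick-nonneg false h = h

  lack-nonneg : ∀ {n} (w : Word n) p → InCone p → 0ℚ ≤ lack w p
  lack-nonneg []                  p h = ≤-refl
  lack-nonneg (⟨ d , a , b ⟩ ∷ w) p (hd , ha , hb , h) =
    +-nonneg (pick-nonneg d hd) (+-nonneg (pick-nonneg a ha) (+-nonneg (pick-nonneg b hb) (lack-nonneg w (tailP p) h)))

  pick-Vanish : ∀ b {q} → pick b q ≡ 0ℚ → Vanish b q
  pick-Vanish true  e = tt
  pick-Vanish false e = e

  Vanish-pick : ∀ b {q} → Vanish b q → pick b q ≡ 0ℚ
  Vanish-pick true  v = refl
  Vanish-pick false v = v

  lack-zero⇒Supp : ∀ {n} (w : Word n) p → InCone p → lack w p ≡ 0ℚ → Supp w p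
  lack-zero⇒Supp [] p h e = tt
  lack-zero⇒Supp (⟨ d , a , b ⟩ ∷ w) p (hd , ha , hb , h) e =
    pick-Vanish d (+-zero-left pd nabw e) , pick-Vanish a (+-zero-left pa nbw e₁) ,
    pick-Vanish b (+-zero-left pb nw e₂) , lack-zero⇒Supp w (tailP p) h (+-zero-right pb nw e₂)
    where
      pd = pick-nonneg d hd
      pa = pick-nonneg a ha
      pb = pick-nonneg b hb
      nw = lack-nonneg w (tailP p) h
      nbw = +-nonneg pb nw
      nabw = +-nonneg pa nbw
      e₁ = +-zero-right pd nabw e
      e₂ = +-zero-right pa nbw e₁

  Supp⇒lack-zero : ∀ {n} (w : Word n) p → Supp w p → lack w p ≡ 0ℚ
  Supp⇒lack-zero [] p s = refl
  Supp⇒lack-zero (⟨ d , a , b ⟩ ∷ w) p (vd , va , vb , s) =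
    cong₂ _+_ (Vanish-pick d vd) (cong₂ _+_ (Vanish-pick a va) (cong₂ _+_ (Vanish-pick b vb) (Supp⇒lack-zero w (tailP p) s)))

  normal : ∀ {r} → Word r → Point r
  normal w = proj₁ (neg-linear (lack-linear w))

  dot-normal : ∀ {r} (w : Word r) p → dot r (normal w) p ≡ - lack w p
  dot-normal w = proj₂ (neg-linear (lack-linear w))

  WordFace : ∀ {r} → Word r → Point r → Set
  WordFace {r} w p = KostkaPolytope r p × Supp w p

  polytope-InCone : ∀ {r} (p : Point r) → KostkaPolytope r p → InCone p
  polytope-InCone p (k , _) = proj₂ (KostkaCone⇒Cone {p = p} k)

  normal-valid : ∀ {r} (w : Word r) → ValidIneq r (KostkaPolytope r) (normal w) 0ℚ
  normal-valid w p h = subst (_≤ 0ℚ) (sym (dot-normal w p)) (neg-nonpos (lack-nonneg w p (polytope-InCone p h)))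

  FaceOf⇒WordFace : ∀ {r} (w : Word r) p → FaceOf r (KostkaPolytope r) (normal w) 0ℚ p → WordFace w p
  FaceOf⇒WordFace w p (h , e) = h , lack-zero⇒Supp w p (polytope-InCone p h)
    (trans (solve 1 (λ u → u := :- (:- u)) refl (lack w p)) (cong -_ (trans (sym (dot-normal w p)) e)))

  WordFace⇒FaceOf : ∀ {r} (w : Word r) p → WordFace w p → FaceOf r (KostkaPolytope r) (normal w) 0ℚ p
  WordFace⇒FaceOf w p (h , s) = h , trans (dot-normal w p) (cong -_ (Supp⇒lack-zero w p s))

  -- Passing from the cone to the polytope

  linear-null : ∀ {n} {g : Point n → ℚ} → IsLinear g → ∀ {p} → p ≈P zeroP n → g p ≡ 0ℚ
  linear-null {g = g} l {p} (ex , ey) =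
    trans (linear-cong l {p} {scaleP 0ℚ p} ((λ i → trans (ex i) (sym (*-zeroˡ (proj₁ p i)))) , (λ i → trans (ey i) (sym (*-zeroˡ (proj₂ p i))))))
      (trans (linear-scale l 0ℚ p) (*-zeroˡ (g p)))

  sum-null : ∀ n {f : Fin n → ℚ} → (∀ i → 0ℚ ≤ f i) → sumℚ n (λ i → 1ℚ * f i) ≡ 0ℚ → ∀ i → f i ≡ 0ℚ
  sum-null (suc n) {f} h e = go
    where
      h₀ : 0ℚ ≤ 1ℚ * f zero
      h₀ = *-nonneg (<⇒≤ 0<1) (h zero)
      hs : 0ℚ ≤ sumℚ n (λ i → 1ℚ * f (suc i))
      hs = sum-nonneg n (λ i → *-nonneg (<⇒≤ 0<1) (h (suc i)))
      go : ∀ i → f i ≡ 0ℚ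
      go zero    = trans (sym (*-identityˡ (f zero))) (+-zero-left h₀ hs e)
      go (suc i) = sum-null n (λ i → h (suc i)) (+-zero-right h₀ hs e) i

  sum1*-nonneg : ∀ n {f : Fin n → ℚ} → (∀ i → 0ℚ ≤ f i) → 0ℚ ≤ sumℚ n (λ i → 1ℚ * f i)
  sum1*-nonneg n h = sum-nonneg n (λ i → *-nonneg (<⇒≤ 0<1) (h i))

  module _ {n} (p : Point n) (h : InCone p) where
    private
      λ-nonneg = descending-nonneg (proj₁ p) (descendingλ p h)
      μ-nonneg = descending-nonneg (proj₂ p) (descendingμ p h)

    total-nonneg : 0ℚ ≤ total p
    total-nonneg = +-nonneg (sum1*-nonneg n λ-nonneg) (sum1*-nonneg n μ-nonneg)

    total-zero : total p ≡ 0ℚ → p ≈P zeroP n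
    total-zero e =
      sum-null n λ-nonneg (+-zero-left (sum1*-nonneg n λ-nonneg) (sum1*-nonneg n μ-nonneg) e) ,
      sum-null n μ-nonneg (+-zero-right (sum1*-nonneg n λ-nonneg) (sum1*-nonneg n μ-nonneg) e)

    total-cases : p ≈P zeroP n ⊎ 0ℚ < total p
    total-cases = cases (sign-of (total p) total-nonneg)
      where
        cases : (Σ Bool λ b → Sign b (total p)) → p ≈P zeroP n ⊎ 0ℚ < total p
        cases (true  , pos) = inj₂ pos
        cases (false , e)   = inj₁ (total-zero e)

  normalise : ∀ {r} (p : Point r) → Cone p → 0ℚ < total p → Σ ℚ λ t → 0ℚ < t × KostkaPolytope r (scaleP t p)
  normalise p c pos = let i , e , 0<i = recip-pos (total p) pos in
    i , 0<i , Cone⇒KostkaCone (Cone-scale i p (<⇒≤ 0<i) c) , trans (linear-scale total-linear i p) e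

  Sign-null : ∀ b {q} → Sign b q → q ≡ 0ℚ → b ≡ false
  Sign-null true  s e = ⊥-elim (pos⇒≢0 s e)
  Sign-null false s e = refl

  -- Hence a word of positive weight is not realised by the apex, and its points can be scaled into
  -- the polytope.
  Exact-null : ∀ {n} (w : Word n) p → Exact w p → p ≈P zeroP n → weight w ≡ 0
  Exact-null [] p _ _ = refl
  Exact-null {suc n} (⟨ d , a , b ⟩ ∷ w) p (sd , sa , sb , e) z =
    cong₂ ℕ._+_ (flags (Sign-null d sd (linear-null excess-linear {tailP p} (tail-≈P {p = p} {zeroP (suc n)} z)))
        (Sign-null a sa (linear-null gapλ-linear {p} z)) (Sign-null b sb (linear-null gapμ-linear {p} z)))
      (Exact-null w (tailP p) e (tail-≈P {p = p} {zeroP (suc n)} z))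
    where
      flags : ∀ {d a b} → d ≡ false → a ≡ false → b ≡ false → letterWeight ⟨ d , a , b ⟩ ≡ 0
      flags refl refl refl = refl

  realise-cone : ∀ {r} (w : Word r) → Valid free w → Σ (Point r) λ p → Cone p × Exact w p
  realise-cone w v = let _ , _ , realisation p e ex _ = realise-free w v in p , (ex , Exact⇒InCone w p e) , e

  realise-polytope : ∀ {r} (w : Word r) → Valid free w → 0 ℕ.< weight w → Σ (Point r) λ p → KostkaPolytope r p × Exact w p
  realise-polytope {r} w v 0<k = go (total-cases p (proj₂ c))
    where
      p = proj₁ (realise-cone w v)
      c = proj₁ (proj₂ (realise-cone w v))
      e = proj₂ (proj₂ (realise-cone w v))
      go : p ≈P zeroP r ⊎ 0ℚ < total p → Σ (Point r) λ p → KostkaPolytope r p × Exact w p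
      go (inj₁ z)   = ⊥-elim (ℕP.<⇒≢ 0<k (sym (Exact-null w p e z)))
      go (inj₂ pos) = let t , 0<t , k = normalise p c pos in scaleP t p , k , Exact-scale w p 0<t e

  -- Every face is a word face

  difference : ∀ {n} → ℚ → Point n → Point n → Point n
  difference t x y = addP (scaleP t x) (scaleP (- 1ℚ) y)

  Sign-dominates : ∀ b {q q'} → Sign b q → Vanish b q' → Σ ℚ λ M → ∀ t → M ≤ t → 0ℚ ≤ t * q - q'
  Sign-dominates false refl refl = 0ℚ , λ t _ → ≤-reflexive (solve 1 (λ t → con 0ℚ := t :* con 0ℚ :- con 0ℚ) refl t)
  Sign-dominates true {q} {q'} pos _ = let i , iq≡1 , 0<i = recip-pos q pos in
    q' * i , λ t M≤t → ≤⇒0≤- (subst (_≤ t * q) (trans (*-assoc q' i q) (trans (cong (q' *_) iq≡1) (*-identityʳ q')))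
      (*-monoʳ-≤-nonNeg q {{nonNegative (<⇒≤ pos)}} M≤t))

  -- The segment from a point y of a face to a relative interior point x extends beyond x. The bound
  -- holds for all t ≥ M, so that the thresholds of the single functionals can be merged by `⊔`.
  Exact-dominates : ∀ {n} (w : Word n) x y → Exact w x → Supp w y → Σ ℚ λ M → ∀ t → M ≤ t → InCone (difference t x y)
  Exact-dominates [] x y _ _ = 0ℚ , λ _ _ → tt
  Exact-dominates (⟨ d , a , b ⟩ ∷ w) x y (sd , sa , sb , e) (vd , va , vb , s) =
    let M₁ , h₁ = Sign-dominates d sd vd
        M₂ , h₂ = Sign-dominates a sa va
        M₃ , h₃ = Sign-dominates b sb vb
        M₄ , h₄ = Exact-dominates w (tailP x) (tailP y) e s
    in (M₁ ⊔ M₂) ⊔ (M₃ ⊔ M₄) , λ t M≤t →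
      let M₁₂≤ = ≤-trans (p≤p⊔q (M₁ ⊔ M₂) (M₃ ⊔ M₄)) M≤t
          M₃₄≤ = ≤-trans (p≤q⊔p (M₁ ⊔ M₂) (M₃ ⊔ M₄)) M≤t
      in subst (0ℚ ≤_) (sym (linear-extrapolate excess-linear t (tailP x) (tailP y))) (h₁ t (≤-trans (p≤p⊔q M₁ M₂) M₁₂≤)) ,
         subst (0ℚ ≤_) (sym (linear-extrapolate gapλ-linear t x y)) (h₂ t (≤-trans (p≤q⊔p M₁ M₂) M₁₂≤)) ,
         subst (0ℚ ≤_) (sym (linear-extrapolate gapμ-linear t x y)) (h₃ t (≤-trans (p≤p⊔q M₃ M₄) M₃₄≤)) ,
         h₄ t (≤-trans (p≤q⊔p M₃ M₄) M₃₄≤)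

  mutual
    valid? : ∀ {n} s (w : Word n) → Dec (Valid s w)
    valid? free   []      = yes tt
    valid? flat   []      = yes tt
    valid? rising []      = no (λ ())
    valid? raised []      = no (λ ())
    valid? s      (ℓ ∷ w) = validFrom? (step s ℓ) w

    validFrom? : ∀ {n} m (w : Word n) → Dec (ValidFrom m w)
    validFrom? (just s) w = valid? s w
    validFrom? nothing  w = no (λ ())

  module SupportingFunctional {r} {h : Point r → ℚ} (h-linear : IsLinear h) (h-nonneg : ∀ p → Cone p → 0ℚ ≤ h p) where

    Contact : Point r → Set
    Contact p = Cone p × h p ≡ 0ℚ

    -- For large t the point t x - y stays in the cone, and h takes the value - h y there.
    contact-spreads : ∀ w x y → Contact x → Exact w x → Cone y → Supp w y → h y ≡ 0ℚ
    contact-spreads w x y ((ex , _) , hx) e cy@(ey , _) s =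
      let M , f = Exact-dominates w x y e s
          z     = difference M x y
          z-excess : excess z ≡ 0ℚ
          z-excess = trans (linear-extrapolate excess-linear M x y)
            (trans (cong₂ (λ u v → M * u - v) ex ey) (solve 1 (λ M → M :* con 0ℚ :- con 0ℚ := con 0ℚ) refl M))
          hz : h z ≡ - h y
          hz = trans (linear-extrapolate h-linear M x y)
            (trans (cong (λ u → M * u - h y) hx) (solve 2 (λ M u → M :* con 0ℚ :- u := :- u) refl M (h y)))
      in nonneg-neg-zero (h-nonneg y cy) (subst (0ℚ ≤_) hz (h-nonneg z (z-excess , f M ≤-refl)))

    -- By `contact-spreads` the points with word `v` are all contacts or none is, so the value of h
    -- at the one point from `realise-cone` decides.
    contact-word? : ∀ v → Dec (Σ (Point r) λ y → Contact y × Exact v y)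
    contact-word? v = decide (valid? free v)
      where
        decide : Dec (Valid free v) → Dec (Σ (Point r) λ y → Contact y × Exact v y)
        decide (no ¬v) = no (λ { (y , ((ey , _) , _) , e) → ¬v (Exact⇒Valid free v y e ey) })
        decide (yes val) = zero? (h y₀ ≟ 0ℚ)
          where
            y₀ = proj₁ (realise-cone v val)
            c₀ = proj₁ (proj₂ (realise-cone v val))
            e₀ = proj₂ (proj₂ (realise-cone v val))
            zero? : Dec (h y₀ ≡ 0ℚ) → Dec (Σ (Point r) λ y → Contact y × Exact v y)
            zero? (yes hz) = yes (y₀ , (c₀ , hz) , e₀)
            zero? (no ¬hz) = no (λ { (y , cy , e) → ¬hz (contact-spreads v y y₀ cy e c₀ (Exact⇒Supp v y₀ e₀)) })

    contact-add : ∀ x y → Contact x → Contact y → Contact (addP x y)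
    contact-add x y (cx , hx) (cy , hy) =
      Cone-add x y cx cy , trans (linear-add h-linear x y) (trans (cong₂ _+_ hx hy) (+-identityˡ 0ℚ))

    Covers : Point r → List (Word r) → Set
    Covers x ws = ∀ v → v ∈ ws → ∀ y → Contact y → Exact v y → ∀ w → Exact w x → v ⊑ w

    -- Contacts are closed under addition, and a sum contains the supports of its summands. With all
    -- words in `ws`, adding one contact per word that has one yields a relative interior point of
    -- the contact set.
    covering-contact : ∀ x₀ → Contact x₀ → ∀ ws → Σ (Point r) λ x → Contact x × Covers x ws
    covering-contact x₀ c₀ [] = x₀ , c₀ , λ _ ()
    covering-contact x₀ c₀ (v ∷ ws) = extend (contact-word? v)
      where
        x  = proj₁ (covering-contact x₀ c₀ ws)
        cx = proj₁ (proj₂ (covering-contact x₀ c₀ ws))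
        cov = proj₂ (proj₂ (covering-contact x₀ c₀ ws))
        extend : Dec (Σ (Point r) λ y → Contact y × Exact v y) → Σ (Point r) λ x → Contact x × Covers x (v ∷ ws)
        extend (no none) = x , cx , λ { u (here refl) y cy e → ⊥-elim (none (y , cy , e)) ; u (there m) → cov u m }
        extend (yes (y₀ , cy₀ , e₀)) = addP y₀ x , contact-add y₀ x cy₀ cx , covers
          where
            u₀ = support x (proj₂ (proj₁ cx))
            covers : Covers (addP y₀ x) (v ∷ ws)
            covers u (here refl) y cy e w ew = Exact-add u w y₀ x e₀ (proj₂ (proj₁ cx)) ew
            covers u (there m)   y cy e w ew = ⊑-trans u (proj₁ u₀) w (cov u m y cy e (proj₁ u₀) (proj₂ u₀))
              (Exact-add (proj₁ u₀) w x y₀ (proj₂ u₀) (proj₂ (proj₁ cy₀))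
                (Exact-cong w {addP y₀ x} {addP x y₀} ((λ i → +-comm (proj₁ y₀ i) (proj₁ x i)) , (λ i → +-comm (proj₂ y₀ i) (proj₂ x i))) ew))

    contact-word : ∀ x₀ → Contact x₀ → Σ (Word r) λ w → Valid free w ×
      (∀ y → Contact y → Supp w y) × (∀ y → Cone y → Supp w y → h y ≡ 0ℚ)
    contact-word x₀ c₀ =
      let x , cx , cov = covering-contact x₀ c₀ (allWords r)
          w , e = support x (proj₂ (proj₁ cx))
      in w , Exact⇒Valid free w x e (proj₁ (proj₁ cx)) ,
         (λ y cy → let v , ev = support y (proj₂ (proj₁ cy)) in Exact-⊑⇒Supp v w y ev (cov v (∈-allWords v) y cy ev w e)) ,
         (λ y cy s → contact-spreads w x y cx e cy s)

  -- Upper bound for the dimension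

  sum-punchIn : ∀ n (f : Fin (suc n) → ℚ) i → sumℚ (suc n) f ≡ f i + sumℚ n (λ k → f (punchIn i k))
  sum-punchIn n       f zero    = refl
  sum-punchIn (suc n) f (suc i) = trans (cong (f zero +_) (sum-punchIn n (λ k → f (suc k)) i))
    (solve 3 (λ a b c → a :+ (b :+ c) := b :+ (a :+ c)) refl (f zero) (f (suc i)) (sumℚ n (λ k → f (suc (punchIn i k)))))

  Dependency : ∀ {m n} → (Fin n → Fin m → ℚ) → Set
  Dependency {m} {n} v = Σ (Fin n → ℚ) λ t → (Σ (Fin n) λ i → t i ≢ 0ℚ) × (∀ j → sumℚ n (λ i → t i * v i j) ≡ 0ℚ)

  module Pivot {m n} (v : Fin (suc n) → Fin (suc m) → ℚ) (i : Fin (suc n)) (inv : ℚ) (inv-v : inv * v i zero ≡ 1ℚ) where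

    ratio : Fin n → ℚ
    ratio k = v (punchIn i k) zero * inv

    eliminated : Fin n → Fin (suc m) → ℚ
    eliminated k j = v (punchIn i k) j - ratio k * v i j

    eliminated-zero : ∀ k → eliminated k zero ≡ 0ℚ
    eliminated-zero k = trans (cong (λ u → a - u) (trans (*-assoc a inv (v i zero)) (trans (cong (a *_) inv-v) (*-identityʳ a)))) (+-inverseʳ a)
      where
        a = v (punchIn i k) zero

    module _ (t : Fin n → ℚ) where

      lifted : Fin (suc n) → ℚ
      lifted = insertAt t i (- sumℚ n (λ k → t k * ratio k))

      lifted-sum : ∀ j → sumℚ (suc n) (λ k → lifted k * v k j) ≡ sumℚ n (λ k → t k * eliminated k j)
      lifted-sum j =
        trans (sum-punchIn n (λ k → lifted k * v k j) i)
        (trans (cong₂ _+_ head (sum-cong n (λ k → cong (_* v (punchIn i k) j) (insertAt-punchIn t i _ k))))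
        (trans (sym (sum-+ n (λ k → - v i j * (t k * ratio k)) (λ k → t k * v (punchIn i k) j)))
          (sum-cong n (λ k → solve 4 (λ x t s y → :- x :* (t :* s) :+ t :* y := t :* (y :- s :* x)) refl (v i j) (t k) (ratio k) (v (punchIn i k) j)))))
        where
          S = sumℚ n (λ k → t k * ratio k)
          head : lifted i * v i j ≡ sumℚ n (λ k → - v i j * (t k * ratio k))
          head = trans (cong (_* v i j) (insertAt-lookup t i (- S)))
            (trans (solve 2 (λ s x → :- s :* x := :- x :* s) refl S (v i j)) (sym (sum-*ˡ n (- v i j) (λ k → t k * ratio k))))

  -- Gaussian elimination on the coordinate `zero`: a vector that is nonzero there clears the others
  -- and is removed, which leaves one vector and one coordinate fewer. If there is no such vector,
  -- the coordinate imposes no condition.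
  dependency : ∀ m n → m ℕ.< n → (v : Fin n → Fin m → ℚ) → Dependency v
  dependency zero    (suc n) _         v = (λ _ → 1ℚ) , (zero , λ ()) , λ ()
  dependency (suc m) (suc n) (s≤s m<n) v = go (any? (λ i → ¬? (v i zero ≟ 0ℚ)))
    where
      go : Dec (Σ (Fin (suc n)) λ i → v i zero ≢ 0ℚ) → Dependency v
      go (no none) =
        let t , nz , e = dependency m (suc n) (ℕP.m≤n⇒m≤1+n m<n) (λ i j → v i (suc j))
        in t , nz , λ { zero → sum-zero (suc n) (λ i → trans (cong (t i *_) (decidable-stable (v i zero ≟ 0ℚ) (λ ne → none (i , ne)))) (*-zeroʳ (t i)))
                      ; (suc j) → e j }
      go (yes (i , v≢0)) = lifted t , (punchIn i k , λ e' → nz (trans (sym (insertAt-punchIn t i _ k)) e')) ,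
        λ { zero → trans (lifted-sum t zero) (sum-zero n (λ k → trans (cong (t k *_) (eliminated-zero k)) (*-zeroʳ (t k))))
          ; (suc j) → trans (lifted-sum t (suc j)) (e j) }
        where
          open Pivot v i (proj₁ (recip (v i zero) v≢0)) (proj₂ (recip (v i zero) v≢0))
          dep = dependency m n m<n (λ k j → eliminated k (suc j))
          t = proj₁ dep
          k = proj₁ (proj₁ (proj₂ dep))
          nz = proj₂ (proj₁ (proj₂ dep))
          e = proj₂ (proj₂ dep)

  -- At a break with `off` set the coordinate is D, joined by a when `lam` and `mu` are both set; at
  -- a zero of D it is a, and only when both are set. The gap b is recovered from a and the second
  -- difference of D.
  coords : ∀ {n} (w : Word n) → Point n → Fin (weight w) → ℚ
  coords []                             p = λ ()
  coords (⟨ false , false , b     ⟩ ∷ w) p = coords w (tailP p)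
  coords (⟨ false , true  , false ⟩ ∷ w) p = coords w (tailP p)
  coords (⟨ false , true  , true  ⟩ ∷ w) p = consF (gapλ p) (coords w (tailP p))
  coords (⟨ true  , false , false ⟩ ∷ w) p = coords w (tailP p)
  coords (⟨ true  , false , true  ⟩ ∷ w) p = consF (excess (tailP p)) (coords w (tailP p))
  coords (⟨ true  , true  , false ⟩ ∷ w) p = consF (excess (tailP p)) (coords w (tailP p))
  coords (⟨ true  , true  , true  ⟩ ∷ w) p = consF (excess (tailP p)) (consF (gapλ p) (coords w (tailP p)))

  consF-linear : ∀ {n k} {g : Point n → ℚ} {f : Point n → Fin k → ℚ} → IsLinear g → (∀ j → IsLinear (λ p → f p j)) →
    ∀ j → IsLinear (λ p → consF (g p) (f p) j)
  consF-linear l ls zero    = l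
  consF-linear l ls (suc j) = ls j

  coords-linear : ∀ {n} (w : Word n) j → IsLinear (λ p → coords w p j)
  coords-linear (⟨ false , false , b     ⟩ ∷ w) j = tail-linear (coords-linear w j)
  coords-linear (⟨ false , true  , false ⟩ ∷ w) j = tail-linear (coords-linear w j)
  coords-linear (⟨ false , true  , true  ⟩ ∷ w) j = consF-linear gapλ-linear (λ j → tail-linear (coords-linear w j)) j
  coords-linear (⟨ true  , false , false ⟩ ∷ w) j = tail-linear (coords-linear w j)
  coords-linear (⟨ true  , false , true  ⟩ ∷ w) j = consF-linear (tail-linear excess-linear) (λ j → tail-linear (coords-linear w j)) j
  coords-linear (⟨ true  , true  , false ⟩ ∷ w) j = consF-linear (tail-linear excess-linear) (λ j → tail-linear (coords-linear w j)) j
  coords-linear (⟨ true  , true  , true  ⟩ ∷ w) j =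
    consF-linear (tail-linear excess-linear) (consF-linear gapλ-linear (λ j → tail-linear (coords-linear w j))) j

  first-null : ∀ {n} {f : Fin n → ℚ} → (∀ i → f i ≡ 0ℚ) → first f ≡ 0ℚ
  first-null {zero}  e = refl
  first-null {suc n} e = e zero

  prepend-null : ∀ {n} {f : Fin (suc n) → ℚ} → gap f ≡ 0ℚ → (∀ i → f (suc i) ≡ 0ℚ) → ∀ i → f i ≡ 0ℚ
  prepend-null {f = f} g e zero = trans (solve 2 (λ a b → a := a :- b :+ b) refl (f zero) (first (λ i → f (suc i))))
    (trans (cong₂ _+_ g (first-null e)) (+-identityˡ 0ℚ))
  prepend-null g e (suc i) = e i

  slope-null : ∀ {n} {p : Point n} → p ≈P zeroP n → slope p ≡ 0ℚ
  slope-null (ex , ey) = cong₂ _-_ (first-null ex) (first-null ey)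

  suc-multiple : ∀ m D σ → D ≡ m * σ → D + σ ≡ (m + 1ℚ) * σ
  suc-multiple m D σ e = trans (cong (_+ σ) e) (solve 2 (λ m s → m :* s :+ s := (m :+ con 1ℚ) :* s) refl m σ)

  -- Between a zero of D and the next break D is linear, so there the excess is a multiple of the slope.
  Multiple : ∀ {n} → Point n → Set
  Multiple p = Σ ℚ λ m → 0ℚ ≤ m × excess p ≡ m * slope p

  zero-multiple : ∀ {n} {p : Point n} → excess p ≡ 0ℚ → Multiple p
  zero-multiple {p = p} e = 0ℚ , ≤-refl , trans e (sym (*-zeroˡ (slope p)))

  -- With excess m σ the next value of D is (m + 1) σ, and m ≥ 0, so D = 0 there forces σ = 0. The
  -- slope of the zero tail is 0 as well, whence a = b, and one vanishing gap yields both.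
  anchored-null : ∀ {n} (p : Point (suc n)) → Multiple p → excess (tailP p) ≡ 0ℚ →
    gapλ p ≡ 0ℚ ⊎ gapμ p ≡ 0ℚ → tailP p ≈P zeroP n → p ≈P zeroP (suc n)
  anchored-null p (m , 0≤m , e) e' which z = prepend-null (proj₁ both) (proj₁ z) , prepend-null (proj₂ both) (proj₂ z)
    where
      σ≡0 : slope p ≡ 0ℚ
      σ≡0 = *-zero-cancelˡ (pos⇒≢0 (+-nonneg-pos 0≤m 0<1)) (trans (sym (suc-multiple m (excess p) (slope p) e)) (trans (sym (excess-tail p)) e'))
      balance : 0ℚ ≡ 0ℚ - gapλ p + gapμ p
      balance = trans (sym (slope-null {p = tailP p} z)) (trans (slope-tail p) (cong (λ s → s - gapλ p + gapμ p) σ≡0))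
      ends : gapλ p ≡ 0ℚ ⊎ gapμ p ≡ 0ℚ → gapλ p ≡ 0ℚ × gapμ p ≡ 0ℚ
      ends (inj₁ a) = a , trans (solve 1 (λ b → b := con 0ℚ :- con 0ℚ :+ b) refl (gapμ p)) (trans (cong (λ u → 0ℚ - u + gapμ p) (sym a)) (sym balance))
      ends (inj₂ b) = trans (solve 2 (λ a b → a := b :- (con 0ℚ :- a :+ b)) refl (gapλ p) (gapμ p)) (trans (cong₂ _-_ b (sym balance)) refl) , b
      both = ends which

  interior-multiple : ∀ {n} (p : Point (suc n)) → Multiple p → gapλ p ≡ 0ℚ → gapμ p ≡ 0ℚ → Multiple (tailP p)
  interior-multiple p (m , 0≤m , e) a b = m + 1ℚ , +-nonneg 0≤m (<⇒≤ 0<1) ,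
    trans (excess-tail p) (trans (suc-multiple m (excess p) (slope p) e) (cong ((m + 1ℚ) *_) (sym
      (trans (slope-tail p) (trans (cong₂ (λ u v → slope p - u + v) a b) (solve 1 (λ s → s :- con 0ℚ :+ con 0ℚ := s) refl (slope p)))))))

  -- This is applied to combinations with coefficients of either sign, so it rests on linear
  -- equations alone. As D has been linear since its last zero, the next break at which it vanishes
  -- makes it vanish on the whole stretch.
  coords-injective : ∀ {n} (w : Word n) p → Supp w p → (∀ j → coords w p j ≡ 0ℚ) → Multiple p → p ≈P zeroP n
  coords-injective [] p s c m = (λ ()) , (λ ())
  coords-injective (⟨ false , false , b ⟩ ∷ w) p (d≡ , a≡ , _ , s) c m =
    anchored-null p m d≡ (inj₁ a≡) (coords-injective w (tailP p) s c (zero-multiple {p = tailP p} d≡))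
  coords-injective (⟨ false , true , false ⟩ ∷ w) p (d≡ , _ , b≡ , s) c m =
    anchored-null p m d≡ (inj₂ b≡) (coords-injective w (tailP p) s c (zero-multiple {p = tailP p} d≡))
  coords-injective (⟨ false , true , true ⟩ ∷ w) p (d≡ , _ , _ , s) c m =
    anchored-null p m d≡ (inj₁ (c zero)) (coords-injective w (tailP p) s (λ j → c (suc j)) (zero-multiple {p = tailP p} d≡))
  coords-injective (⟨ true , false , false ⟩ ∷ w) p (_ , a≡ , b≡ , s) c m =
    let z = coords-injective w (tailP p) s c (interior-multiple p m a≡ b≡)
    in prepend-null a≡ (proj₁ z) , prepend-null b≡ (proj₂ z)
  coords-injective (⟨ true , false , true ⟩ ∷ w) p (_ , a≡ , _ , s) c m =
    anchored-null p m (c zero) (inj₁ a≡) (coords-injective w (tailP p) s (λ j → c (suc j)) (zero-multiple {p = tailP p} (c zero)))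
  coords-injective (⟨ true , true , false ⟩ ∷ w) p (_ , _ , b≡ , s) c m =
    anchored-null p m (c zero) (inj₂ b≡) (coords-injective w (tailP p) s (λ j → c (suc j)) (zero-multiple {p = tailP p} (c zero)))
  coords-injective (⟨ true , true , true ⟩ ∷ w) p (_ , _ , _ , s) c m =
    anchored-null p m (c zero) (inj₁ (c (suc zero))) (coords-injective w (tailP p) s (λ j → c (suc (suc j))) (zero-multiple {p = tailP p} (c zero)))

  Vanish-lincomb : ∀ b {n} {g : Point n → ℚ} → IsLinear g → ∀ k t (v : Fin k → Point n) → (∀ i → Vanish b (g (v i))) → Vanish b (g (lincomb n k t v))
  Vanish-lincomb true  l k t v h = tt
  Vanish-lincomb false l k t v h = trans (linear-lincomb l k t v) (sum-zero k (λ i → trans (cong (t i *_) (h i)) (*-zeroʳ (t i))))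

  Supp-lincomb : ∀ {n} (w : Word n) k t (v : Fin k → Point n) → (∀ i → Supp w (v i)) → Supp w (lincomb n k t v)
  Supp-lincomb [] k t v h = tt
  Supp-lincomb (⟨ d , a , b ⟩ ∷ w) k t v h =
    Vanish-lincomb d (tail-linear excess-linear) k t v (λ i → proj₁ (h i)) ,
    Vanish-lincomb a gapλ-linear k t v (λ i → proj₁ (proj₂ (h i))) ,
    Vanish-lincomb b gapμ-linear k t v (λ i → proj₁ (proj₂ (proj₂ (h i)))) ,
    Supp-lincomb w k t (λ i → tailP (v i)) (λ i → proj₂ (proj₂ (proj₂ (h i))))

  -- A dependency among the coordinate vectors is, by injectivity, one among the points. All points
  -- have `total` 1, so the coefficients sum to 0 and the dependency is affine.
  WordFace-dependent : ∀ {r} (w : Word r) n → weight w ℕ.≤ n → (v : Fin (suc n) → Point r) → (∀ i → WordFace w (v i)) →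
    ¬ AffinelyIndependent r n v
  WordFace-dependent {r} w n w≤n v face indep = nz (indep t t-sum null i)
    where
      dep = dependency (weight w) (suc n) (s≤s w≤n) (λ i → coords w (v i))
      t = proj₁ dep
      i = proj₁ (proj₁ (proj₂ dep))
      nz = proj₂ (proj₁ (proj₂ dep))
      z = lincomb r (suc n) t v
      z-excess : excess z ≡ 0ℚ
      z-excess = trans (linear-lincomb excess-linear (suc n) t v) (sum-zero (suc n)
        (λ i → trans (cong (t i *_) (proj₁ (KostkaCone⇒Cone {p = v i} (proj₁ (proj₁ (face i)))))) (*-zeroʳ (t i))))
      null : z ≈P zeroP r
      null = coords-injective w z (Supp-lincomb w (suc n) t v (λ i → proj₂ (face i)))
        (λ j → trans (linear-lincomb (coords-linear w j) (suc n) t v) (proj₂ (proj₂ dep) j)) (zero-multiple {p = z} z-excess)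
      t-sum : sumℚ (suc n) t ≡ 0ℚ
      t-sum = trans (sum-cong (suc n) (λ i → sym (trans (cong (t i *_) (proj₂ (proj₁ (face i)))) (*-identityʳ (t i)))))
        (trans (sym (linear-lincomb total-linear (suc n) t v)) (linear-null total-linear {z} null))

  -- Lower bound for the dimension

  LinearlyIndependent : ∀ r k → (Fin k → Point r) → Set
  LinearlyIndependent r k v = ∀ t → lincomb r k t v ≈P zeroP r → ∀ i → t i ≡ 0ℚ

  consV : ∀ {r k} → Point r → (Fin k → Point r) → Fin (suc k) → Point r
  consV x v zero    = x
  consV x v (suc i) = v i

  WordFace-mono : ∀ {r} (w v : Word r) → w ⊑ v → ∀ p → WordFace w p → WordFace v p
  WordFace-mono w v le p (h , s) = h , Supp-mono w v p (polytope-InCone p h) le s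

  -- On a vanishing combination `lack w` isolates the coefficient of x, because it is zero at all
  -- the other points.
  extend-independent : ∀ {r k} (w : Word r) (x : Point r) (v : Fin k → Point r) → lack w x ≢ 0ℚ → (∀ i → Supp w (v i)) →
    LinearlyIndependent r k v → LinearlyIndependent r (suc k) (consV x v)
  extend-independent {r} {k} w x v x≢0 sv indep t (e₁ , e₂) = go
    where
      z = lincomb r (suc k) t (consV x v)
      t₀≡0 : t zero ≡ 0ℚ
      t₀≡0 = *-zero-cancelˡ x≢0 (trans (*-comm (lack w x) (t zero))
        (trans (sym (+-identityʳ (t zero * lack w x)))
        (trans (cong (t zero * lack w x +_) (sym (sum-zero k (λ i → trans (cong (t (suc i) *_) (Supp⇒lack-zero w (v i) (sv i))) (*-zeroʳ (t (suc i)))))))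
        (trans (sym (linear-lincomb (lack-linear w) (suc k) t (consV x v))) (linear-null (lack-linear w) {z} (e₁ , e₂))))))
      drop : ∀ q s → t zero * q + s ≡ 0ℚ → s ≡ 0ℚ
      drop q s e = trans (solve 2 (λ q s → s := con 0ℚ :* q :+ s) refl q s) (trans (cong (λ u → u * q + s) (sym t₀≡0)) e)
      go : ∀ i → t i ≡ 0ℚ
      go zero    = t₀≡0
      go (suc i) = indep (λ i → t (suc i)) ((λ j → drop _ _ (e₁ j)) , (λ j → drop _ _ (e₂ j))) i

  independent-family : ∀ {r} k (w : Word r) → Valid free w → weight w ≡ k →
    Σ (Fin k → Point r) λ v → (∀ i → WordFace w (v i)) × LinearlyIndependent r k v
  independent-family zero    w val e = (λ ()) , (λ ()) , λ _ _ ()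
  independent-family {r} (suc k) w val e = consV x v ,
    (λ { zero → xP , Exact⇒Supp w x xE ; (suc i) → WordFace-mono w' w w'⊑w (v i) (faces i) }) ,
    extend-independent w' x v x∉ (λ i → proj₂ (faces i)) indep
    where
      0<w : 0 ℕ.< weight w
      0<w = subst (0 ℕ.<_) (sym e) (s≤s z≤n)
      low = lower-free w val 0<w
      w' = proj₁ low
      w'⊑w = proj₁ (proj₂ low)
      low-weight = proj₂ (proj₂ (proj₂ low))
      rec = independent-family k w' (proj₁ (proj₂ (proj₂ low))) (ℕP.suc-injective (trans low-weight e))
      v = proj₁ rec
      faces = proj₁ (proj₂ rec)
      indep = proj₂ (proj₂ rec)
      top = realise-polytope w val 0<w
      x = proj₁ top
      xP = proj₁ (proj₂ top)
      xE = proj₂ (proj₂ top)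
      x∉ : lack w' x ≢ 0ℚ
      -- If `lack w'` vanished at x, the exact word `w` of x would lie below `w'`, and the two would
      -- coincide although their weights differ.
      x∉ z = ℕP.1+n≢n (trans low-weight (cong weight (⊑-antisym w w' (Exact-Supp⇒⊑ w w' x xE (lack-zero⇒Supp w' x (polytope-InCone x xP) z)) w'⊑w)))

  -- Faces of dimension d and words of weight d + 1

  word-IsFaceOfDim : ∀ {r d} (w : Word r) → Valid free w → weight w ≡ suc d → IsFaceOfDim r (KostkaPolytope r) d (normal w) 0ℚ
  word-IsFaceOfDim {r} {d} w val e =
    normal-valid w ,
    (let v , faces , indep = independent-family (suc d) w val e
     in v , (λ i → WordFace⇒FaceOf w (v i) (faces i)) , (λ t _ z → indep t z)) ,
    (λ v faces → WordFace-dependent w (suc d) (ℕP.≤-reflexive e) v (λ i → FaceOf⇒WordFace w (v i) (faces i)))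

  face⇒word : ∀ {r d} c b → IsFaceOfDim r (KostkaPolytope r) d c b →
    Σ (Word r) λ w → Valid free w × weight w ≡ suc d ×
      SameSet r (FaceOf r (KostkaPolytope r) c b) (FaceOf r (KostkaPolytope r) (normal w) 0ℚ)
  face⇒word {r} {d} c b (valid , (v , faces , indep) , maximal) =
    w , val , ℕP.≤-antisym weight≤ weight≥ , λ x → (λ f → WordFace⇒FaceOf w x (to x f)) , (λ f → from x (FaceOf⇒WordFace w x f))
    where
      -- As `total` is 1 on the polytope, h is the slack of the inequality there; being homogeneous,
      -- it is nonnegative on the whole cone.
      h : Point r → ℚ
      h p = b * total p - dot r c p
      h-linear : IsLinear h
      h-linear = sub-linear (scale-linear b total-linear) (dot-linear r c)
      h-polytope : ∀ p → KostkaPolytope r p → h p ≡ b - dot r c p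
      h-polytope p (_ , e) = cong (_- dot r c p) (trans (cong (b *_) e) (*-identityʳ b))
      h-nonneg : ∀ p → Cone p → 0ℚ ≤ h p
      h-nonneg p cp = cases (total-cases p (proj₂ cp))
        where
          cases : p ≈P zeroP r ⊎ 0ℚ < total p → 0ℚ ≤ h p
          cases (inj₁ z) = ≤-reflexive (sym (linear-null h-linear {p} z))
          cases (inj₂ pos) =
            let t , 0<t , k = normalise p cp pos
            in *-cancelˡ-≤-pos t {{positive 0<t}} (subst₂ _≤_ (sym (*-zeroʳ t)) (linear-scale h-linear t p)
                 (subst (0ℚ ≤_) (sym (h-polytope (scaleP t p) k)) (≤⇒0≤- (valid (scaleP t p) k))))
      open SupportingFunctional h-linear h-nonneg
      touching : ∀ x → FaceOf r (KostkaPolytope r) c b x → Contact x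
      touching x (xP , e) = KostkaCone⇒Cone {p = x} (proj₁ xP) , trans (h-polytope x xP) (trans (cong (λ u → b - u) e) (+-inverseʳ b))
      -- A face of dimension d ≥ 0 contains a point, from which the search for a maximal support
      -- starts.
      the-word = contact-word (v zero) (touching (v zero) (faces zero))
      w = proj₁ the-word
      val = proj₁ (proj₂ the-word)
      to : ∀ x → FaceOf r (KostkaPolytope r) c b x → WordFace w x
      to x f = proj₁ f , proj₁ (proj₂ (proj₂ the-word)) x (touching x f)
      from : ∀ x → WordFace w x → FaceOf r (KostkaPolytope r) c b x
      from x (xP , s) = xP , trans (solve 2 (λ b u → u := b :- (b :- u)) refl b (dot r c x))
        (trans (cong (λ u → b - u) (trans (sym (h-polytope x xP)) (proj₂ (proj₂ (proj₂ the-word)) x (KostkaCone⇒Cone {p = x} (proj₁ xP)) s)))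
          (solve 1 (λ b → b :- con 0ℚ := b) refl b))
      weight≥ : suc d ℕ.≤ weight w
      weight≥ = ℕP.≮⇒≥ (λ lt → WordFace-dependent w d (ℕ.s≤s⁻¹ lt) v (λ i → to (v i) (faces i)) indep)
      weight≤ : weight w ℕ.≤ suc d
      weight≤ = ℕP.≮⇒≥ (λ lt →
        -- Maximality of d speaks of families of exactly d + 2 points, so a heavier word is lowered
        -- to weight d + 2.
        let w' , le , val' , e = subword-of-weight (weight w ℕ.∸ suc (suc d)) w val (sym (ℕP.m∸n+n≡m lt))
            u , faces' , indep' = independent-family (suc (suc d)) w' val' e
        in maximal u (λ i → from (u i) (WordFace-mono w' w le (u i) (faces' i))) (λ t _ z → indep' t z))

  SameSet⇒⊑ : ∀ {r} (w v : Word r) → Valid free w → 0 ℕ.< weight w →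
    (∀ x → FaceOf r (KostkaPolytope r) (normal w) 0ℚ x → FaceOf r (KostkaPolytope r) (normal v) 0ℚ x) → w ⊑ v
  SameSet⇒⊑ w v val 0<w f =
    let x , xP , xE = realise-polytope w val 0<w
    in Exact-Supp⇒⊑ w v x xE (proj₂ (FaceOf⇒WordFace v x (f x (WordFace⇒FaceOf w x (xP , Exact⇒Supp w x xE)))))

  lookup-injective : ∀ {A : Set} {xs : List A} → Unique xs → ∀ i j → lookup xs i ≡ lookup xs j → i ≡ j
  lookup-injective (_ ∷ _)  zero    zero    e = refl
  lookup-injective (h ∷ _)  zero    (suc j) e = ⊥-elim (All.lookup h (∈-lookup j) e)
  lookup-injective (h ∷ _)  (suc i) zero    e = ⊥-elim (All.lookup h (∈-lookup i) (sym e))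
  lookup-injective (_ ∷ hs) (suc i) (suc j) e = cong suc (lookup-injective hs i j e)

  faceCount : ℕ → ℕ → ℕ
  faceCount d r = length (words free r (suc d))

  faceCount-correct : ∀ d r → HasFaceCount r (KostkaPolytope r) d (faceCount d r)
  faceCount-correct d r =
    (λ i → normal (lookup ws i) , 0ℚ) ,
    (λ i → word-IsFaceOfDim (lookup ws i) (val i) (wt i)) ,
    (λ i j i≢j same → i≢j (lookup-injective (unique-words free r (suc d)) i j
      (⊑-antisym (lookup ws i) (lookup ws j)
        (SameSet⇒⊑ (lookup ws i) (lookup ws j) (val i) (pos i) (λ x → proj₁ (same x)))
        (SameSet⇒⊑ (lookup ws j) (lookup ws i) (val j) (pos j) (λ x → proj₂ (same x)))))) ,
    λ c b face →
      let w , v , e , same = face⇒word c b face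
          mem = subst (λ k → w ∈ words free r k) e (∈-words free w v)
      in index mem , subst (λ u → SameSet r (FaceOf r (KostkaPolytope r) c b) (FaceOf r (KostkaPolytope r) (normal u) 0ℚ)) (lookup-index mem) same
    where
      ws = words free r (suc d)
      val : ∀ i → Valid free (lookup ws i)
      val i = proj₁ (words-valid free (lookup ws i) (suc d) (∈-lookup i))
      wt : ∀ i → weight (lookup ws i) ≡ suc d
      wt i = proj₂ (words-valid free (lookup ws i) (suc d) (∈-lookup i))
      pos : ∀ i → 0 ℕ.< weight (lookup ws i)
      pos i = subst (0 ℕ.<_) (sym (wt i)) (s≤s z≤n)

open Geometry using (faceCount; faceCount-correct)
open ℤ using (ℤ; +_) renaming (_+_ to _+ℤ_; _*_ to _*ℤ_; _-_ to _-ℤ_)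

-- Binomial inversion

sumUpTo : (ℕ → ℤ) → ℕ → ℤ
sumUpTo g N = foldr _+ℤ_ (+ 0) (applyUpTo g N)

sumUpTo-cong : ∀ {f g} N → (∀ i → i ℕ.< N → f i ≡ g i) → sumUpTo f N ≡ sumUpTo g N
sumUpTo-cong zero    e = refl
sumUpTo-cong (suc N) e = cong₂ _+ℤ_ (e 0 (s≤s z≤n)) (sumUpTo-cong N (λ i lt → e (suc i) (s≤s lt)))

sumUpTo-zero : ∀ {f} N → (∀ i → f i ≡ + 0) → sumUpTo f N ≡ + 0
sumUpTo-zero zero    e = refl
sumUpTo-zero (suc N) e = cong₂ _+ℤ_ (e 0) (sumUpTo-zero N (λ i → e (suc i)))

sumUpTo-+ : ∀ f g N → sumUpTo (λ i → f i +ℤ g i) N ≡ sumUpTo f N +ℤ sumUpTo g N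
sumUpTo-+ f g zero    = refl
sumUpTo-+ f g (suc N) = trans (cong (f 0 +ℤ g 0 +ℤ_) (sumUpTo-+ (λ i → f (suc i)) (λ i → g (suc i)) N)) (lem (f 0) (g 0) _ _)
  where
    lem : ∀ a b c d → a +ℤ b +ℤ (c +ℤ d) ≡ a +ℤ c +ℤ (b +ℤ d)
    lem = ℤSolver.solve-∀

sumUpTo-snoc : ∀ f N → sumUpTo f (suc N) ≡ sumUpTo f N +ℤ f N
sumUpTo-snoc f zero    = ℤP.+-comm (f 0) (+ 0)
sumUpTo-snoc f (suc N) = trans (cong (f 0 +ℤ_) (sumUpTo-snoc (λ i → f (suc i)) N)) (sym (ℤP.+-assoc (f 0) _ _))

sumUpTo-drop : ∀ {f} a N → a ℕ.≤ N → (∀ j → j ℕ.< a → f j ≡ + 0) → sumUpTo f N ≡ sumUpTo (λ i → f (a ℕ.+ i)) (N ℕ.∸ a)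
sumUpTo-drop zero    N       _         e = refl
sumUpTo-drop {f} (suc a) (suc N) (s≤s a≤N) e =
  trans (cong (_+ℤ sumUpTo (λ i → f (suc i)) N) (e 0 (s≤s z≤n)))
    (trans (ℤP.+-identityˡ _) (sumUpTo-drop a N a≤N (λ j lt → e (suc j) (s≤s lt))))

sumUpTo-extend : ∀ {f} M k → (∀ j → M ℕ.≤ j → f j ≡ + 0) → sumUpTo f (M ℕ.+ k) ≡ sumUpTo f M
sumUpTo-extend zero    k e = sumUpTo-zero k (λ i → e i z≤n)
sumUpTo-extend {f} (suc M) k e = cong (f 0 +ℤ_) (sumUpTo-extend M k (λ j le → e (suc j) (s≤s le)))

binomialTerm : (ℕ → ℕ) → ℕ → ℕ → ℤ
binomialTerm h n j = + h j *ℤ + (n C j)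

binomialTerm-zero : ∀ {h n j} → h j ≡ 0 → binomialTerm h n j ≡ + 0
binomialTerm-zero {h} {n} {j} e = trans (cong (λ z → + z *ℤ + (n C j)) e) (ℤP.*-zeroˡ (+ (n C j)))

binomialTerm-large : ∀ {h n j} → n ℕ.< j → binomialTerm h n j ≡ + 0
binomialTerm-large {h} {n} {j} lt = trans (cong (λ z → + h j *ℤ + z) (k>n⇒nCk≡0 lt)) (ℤP.*-zeroʳ (+ h j))

binomialTerm-pascal : ∀ h n j → binomialTerm h (suc n) (suc j) ≡ binomialTerm h n (suc j) +ℤ binomialTerm (λ i → h (suc i)) n j
binomialTerm-pascal h n j = trans (cong (λ z → + h (suc j) *ℤ + z) (trans (sym (nCk+nC[k+1]≡[n+1]C[k+1] n j)) (ℕP.+-comm (n C j) (n C suc j))))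
  (ℤP.*-distribˡ-+ (+ h (suc j)) (+ (n C suc j)) (+ (n C j)))

-- The terms past n vanish with the binomial coefficient. The slack `k` allows both halves of
-- Pascal's rule to be summed over matching ranges.
bt≡sumUpTo : ∀ h n k → + binomialTransform h n ≡ sumUpTo (binomialTerm h n) (suc n ℕ.+ k)
bt≡sumUpTo h zero    k = trans (sym (trans (ℤP.+-identityʳ (+ h 0 *ℤ + 1)) (ℤP.*-identityʳ (+ h 0))))
  (cong (+ h 0 *ℤ + 1 +ℤ_) (sym (sumUpTo-zero k (λ i → binomialTerm-large {h} (s≤s z≤n)))))
bt≡sumUpTo h (suc n) k =
  trans (cong₂ _+ℤ_ (trans (bt≡sumUpTo h n (suc k)) (cong (sumUpTo (binomialTerm h n)) (ℕP.+-suc (suc n) k))) (bt≡sumUpTo (λ i → h (suc i)) n k))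
  (trans (ℤP.+-assoc (binomialTerm h n 0) _ _)
  (cong (binomialTerm h n 0 +ℤ_)
    (trans (sym (sumUpTo-+ (λ j → binomialTerm h n (suc j)) (binomialTerm (λ i → h (suc i)) n) (suc n ℕ.+ k)))
      (sumUpTo-cong (suc n ℕ.+ k) (λ j _ → sym (binomialTerm-pascal h n j))))))

module BinomialInversion (h : ℕ → ℕ) (a U : ℕ) (a≤U : a ℕ.≤ suc U)
  (below : ∀ j → j ℕ.< a → h j ≡ 0) (above : ∀ j → U ℕ.< j → h j ≡ 0) where

  f : ℕ → ℕ
  f = binomialTransform h

  f-at-a : f a ≡ h a
  f-at-a = bt-top a below

  module _ (α : ℕ → ℤ) (α-a : α a ≡ + f a)
    (α-rec : ∀ k → a ℕ.< k → α k ≡ + f k -ℤ sumRangeℤ a (k ℕ.∸ 1) (λ j → + (k C j) *ℤ α j)) where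

    -- The recurrence is a triangular system with diagonal entries (k choose k) = 1, and `h` solves
    -- it: the term j = k is split off the expansion of `f k`.
    α≡h : ∀ k → a ℕ.≤ k → α k ≡ + h k
    α≡h = <-rec (λ k → a ℕ.≤ k → α k ≡ + h k) recurse
      where
        recurse : ∀ k → (∀ {j} → j ℕ.< k → a ℕ.≤ j → α j ≡ + h j) → a ℕ.≤ k → α k ≡ + h k
        recurse k rec a≤k with ℕP.m≤n⇒m<n∨m≡n a≤k
        ... | inj₂ refl = trans α-a (cong +_ f-at-a)
        recurse (suc k) rec a≤k | inj₁ a<k = trans (α-rec (suc k) a<k)
          (trans (cong₂ _-ℤ_ split range) (lem (sumUpTo (binomialTerm h (suc k)) (suc k)) (+ h (suc k))))
          where
            lem : ∀ s t → s +ℤ t -ℤ s ≡ t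
            lem = ℤSolver.solve-∀
            split : + f (suc k) ≡ sumUpTo (binomialTerm h (suc k)) (suc k) +ℤ + h (suc k)
            split = trans (bt≡sumUpTo h (suc k) 0) (trans (cong (sumUpTo (binomialTerm h (suc k))) (ℕP.+-identityʳ (suc (suc k))))
              (trans (sumUpTo-snoc (binomialTerm h (suc k)) (suc k))
                (cong (sumUpTo (binomialTerm h (suc k)) (suc k) +ℤ_)
                  (trans (cong (λ z → + h (suc k) *ℤ + z) (nCn≡1 (suc k))) (ℤP.*-identityʳ (+ h (suc k)))))))
            range : sumRangeℤ a k (λ j → + (suc k C j) *ℤ α j) ≡ sumUpTo (binomialTerm h (suc k)) (suc k)
            range = sym (trans (sumUpTo-drop a (suc k) a≤k (λ j lt → binomialTerm-zero {h} {suc k} (below j lt)))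
              (sumUpTo-cong (suc k ℕ.∸ a) (λ i lt →
                trans (ℤP.*-comm (+ h (a ℕ.+ i)) (+ (suc k C (a ℕ.+ i))))
                  (cong (+ (suc k C (a ℕ.+ i)) *ℤ_) (sym (rec (a+i<k i lt) (ℕP.m≤m+n a i)))))))
              where
                a+i<k : ∀ i → i ℕ.< suc k ℕ.∸ a → a ℕ.+ i ℕ.< suc k
                a+i<k i lt = subst₂ ℕ._≤_ (ℕP.+-suc a i) (ℕP.m+[n∸m]≡n a≤k) (ℕP.+-monoʳ-≤ a lt)

    inversion : ∀ r → + f r ≡ sumRangeℤ a U (λ k → α k *ℤ + (r C k))
    -- With slack U the sum reaches past both r and U, so it can be cut at U by `above` whichever of
    -- the two is larger.
    inversion r = trans (bt≡sumUpTo h r U) (trans (cong (sumUpTo (binomialTerm h r)) (cong suc (ℕP.+-comm r U)))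
      (trans (sumUpTo-extend (suc U) r (λ j lt → binomialTerm-zero {h} {r} (above j lt)))
      (trans (sumUpTo-drop a (suc U) a≤U (λ j lt → binomialTerm-zero {h} {r} (below j lt)))
        (sumUpTo-cong (suc U ℕ.∸ a) (λ i _ → cong (_*ℤ + (r C (a ℕ.+ i))) (sym (α≡h (a ℕ.+ i) (ℕP.m≤m+n a i))))))))

-- The ends of the range and the value at d_min

halves : ∀ d → (Σ ℕ λ m → d ≡ double m) ⊎ (Σ ℕ λ m → d ≡ suc (double m))
halves zero = inj₁ (0 , refl)
halves (suc d) with halves d
... | inj₁ (m , e) = inj₂ (m , cong suc e)
... | inj₂ (m , e) = inj₁ (suc m , cong suc e)

⌊double/2⌋ : ∀ m → ⌊ double m /2⌋ ≡ m
⌊double/2⌋ zero    = refl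
⌊double/2⌋ (suc m) = cong suc (⌊double/2⌋ m)

⌊suc-double/2⌋ : ∀ m → ⌊ suc (double m) /2⌋ ≡ m
⌊suc-double/2⌋ zero    = refl
⌊suc-double/2⌋ (suc m) = cong suc (⌊suc-double/2⌋ m)

double≡*2 : ∀ m → double m ≡ m ℕ.* 2
double≡*2 m = trans (double≡ m) (ℕP.*-comm 2 m)

double%2 : ∀ m → double m ℕ.% 2 ≡ 0
double%2 m = trans (cong (ℕ._% 2) (double≡*2 m)) (DivMod.m*n%n≡0 m 2)

suc-double%2 : ∀ m → suc (double m) ℕ.% 2 ≡ 1
suc-double%2 m = trans (cong (λ z → suc z ℕ.% 2) (double≡*2 m)) (DivMod.[m+kn]%n≡m%n 1 m 2)

dmin-even : ∀ m → dmin (double m) ≡ suc m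
dmin-even m = trans (cong ⌊_/2⌋ (ℕP.+-comm (double m) 3)) (cong suc (⌊suc-double/2⌋ m))

dmin-odd : ∀ m → dmin (suc (double m)) ≡ suc (suc m)
dmin-odd m = trans (cong ⌊_/2⌋ (ℕP.+-comm (suc (double m)) 3)) (cong (λ z → suc (suc z)) (⌊double/2⌋ m))

dminValue-even : ∀ m → dminValue (double m) ≡ 1
dminValue-even m rewrite double%2 m = refl

dminValue-odd : ∀ m → dminValue (suc (double (suc m))) ≡ 3 ℕ.* m ℕ.+ 7
dminValue-odd m rewrite suc-double%2 (suc m) =
  trans (cong ⌊_/2⌋ (trans (cong (λ z → 3 ℕ.* suc z ℕ.+ 5) (double≡ (suc m))) (trans (lem m) (sym (double≡ (3 ℕ.* m ℕ.+ 7))))))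
    (⌊double/2⌋ (3 ℕ.* m ℕ.+ 7))
  where
    lem : ∀ m → 3 ℕ.* suc (2 ℕ.* suc m) ℕ.+ 5 ≡ 2 ℕ.* (3 ℕ.* m ℕ.+ 7)
    lem = solve-∀

reduced-dmin : ∀ d → reduced (dmin d) free (suc d) ≡ dminValue d
reduced-dmin d with halves d
... | inj₁ (m , refl) =
  trans (cong (λ n → reduced n free (suc (double m))) (dmin-even m)) (trans (reduced-free-top m) (sym (dminValue-even m)))
-- This is d = 1, settled by computation; the general odd formula starts at d = 3.
... | inj₂ (zero , refl) = refl
... | inj₂ (suc m , refl) =
  trans (cong (λ n → reduced n free (double (suc (suc m)))) (dmin-odd (suc m))) (trans (reduced-free-double m) (sym (dminValue-odd m)))

double-dmin≤ : ∀ d → double (dmin d) ℕ.≤ d ℕ.+ 3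
double-dmin≤ d = lem (d ℕ.+ 3)
  where
    lem : ∀ n → double ⌊ n /2⌋ ℕ.≤ n
    lem zero          = z≤n
    lem (suc zero)    = z≤n
    lem (suc (suc n)) = s≤s (s≤s (lem n))

reduced-below : ∀ d j → j ℕ.< dmin d → reduced j free (suc d) ≡ 0
reduced-below d j lt = reduced-tooHeavy j free (suc d) (ℕP.+-cancelˡ-≤ 2 _ _ (begin
    2 ℕ.+ 2 ℕ.* j       ≡⟨ ℕP.*-suc 2 j ⟨
    2 ℕ.* suc j         ≤⟨ ℕP.*-monoʳ-≤ 2 lt ⟩
    2 ℕ.* dmin d        ≡⟨ double≡ (dmin d) ⟨
    double (dmin d)     ≤⟨ double-dmin≤ d ⟩
    d ℕ.+ 3             ≡⟨ ℕP.+-comm d 3 ⟩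
    2 ℕ.+ suc d         ∎) , s≤s z≤n)
  where open ℕP.≤-Reasoning

reduced-above : ∀ d j → 3 ℕ.* d ℕ.+ 3 ℕ.< j → reduced j free (suc d) ≡ 0
reduced-above d j lt = reduced-tooLong j free (suc d) (subst (ℕ._≤ j) (lem d) lt)
  where
    lem : ∀ d → suc (3 ℕ.* d ℕ.+ 3) ≡ 3 ℕ.* suc d ℕ.+ 1
    lem = solve-∀

dmin≤ : ∀ d → dmin d ℕ.≤ suc (3 ℕ.* d ℕ.+ 3)
dmin≤ d = ℕP.≤-trans (ℕP.⌊n/2⌋≤n (d ℕ.+ 3)) (ℕP.m≤n⇒m≤1+n (ℕP.+-monoˡ-≤ 3 (ℕP.m≤m+n d (d ℕ.+ (d ℕ.+ 0)))))

faceCount≡ : ∀ d r → faceCount d r ≡ binomialTransform (λ j → reduced j free (suc d)) r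
faceCount≡ d r = trans (length-words r free (suc d)) (count≡bt r free (suc d))

open import Data.Nat using (_≤_; _<_; _*_; _+_)
open import Data.Integer using (_-_)

theorem5p3 : (d : ℕ) →
    Σ (ℕ → ℕ) λ f →
    (∀ r → 1 ≤ r → HasFaceCount r (KostkaPolytope r) d (f r)) ×
    (f (dmin d) ≡ dminValue d) ×
    (∀ (α : ℕ → ℤ) →
    α (dmin d) ≡ + f (dmin d) →
    (∀ k → dmin d < k →
    α k ≡ + f k - sumRangeℤ (dmin d) (k Data.Nat.∸ 1) (λ j → + (k C j) *ℤ α j)) →
    ∀ r → 1 ≤ r →
    + f r ≡ sumRangeℤ (dmin d) (3 * d + 3) (λ k → α k *ℤ + (r C k)))
theorem5p3 d =
  faceCount d ,
  (λ r _ → faceCount-correct d r) ,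
  trans (faceCount≡ d (dmin d)) (trans f-at-a (reduced-dmin d)) ,
  λ α α-dmin α-rec r _ → trans (cong +_ (faceCount≡ d r))
    (inversion α (trans α-dmin (cong +_ (faceCount≡ d (dmin d))))
      (λ k lt → trans (α-rec k lt) (cong (λ z → + z - sumRangeℤ (dmin d) (k Data.Nat.∸ 1) (λ j → + (k C j) *ℤ α j)) (faceCount≡ d k))) r)
  where
    open BinomialInversion (λ j → reduced j free (suc d)) (dmin d) (3 * d + 3) (dmin≤ d) (reduced-below d) (reduced-above d)
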